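{- Consider scheduling with uncertain processing times on $m\ge1$ machines with the objective of minimizing the total completion time, and let $\beta>0$. For a job $k$ let $\mathbb P_k\in[0,1]$ denote the probability with which the algorithm $\beta$-RPCPM tests $k$, let $p_k^*=\min\{u_k,t_k+p_k\}$, and let $$R=\max_k\frac{(1+\frac1\beta)\,u_k\,(1-\mathbb P_k)+\max\{2t_k+p_k,\ \beta t_k,\ (1+\frac1\beta)(t_k+p_k)\}\,\mathbb P_k}{p_k^*},$$ $$r=\max_j\frac{u_j(1-\mathbb P_j)+(t_j+p_j)\mathbb P_j}{p_j^*},$$ where the maxima (suprema, assumed finite) are over all possible jobs, i.e. all triples $(t,u,p)$ with $t,u>0$ and $p\in[0,u]$. If $R\le 2r$, then the expected competitive ratio of $\beta$-RPCPM is at most $$R\left(\frac12+\frac1{2m}\right)+r\left(1-\frac1m\right).$$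
   Context: Problem. There are $n$ jobs, all available at time $0$, and $m$ identical machines, each of which runs one task at a time. Job $j$ has a testing time $t_j> 0$, an upper limit $u_j> 0$, and a real processing time $p_j\in[0,u_j]$. A job may be executed untested, which takes $u_j$ time units, or it may be tested (taking $t_j$ time units) and afterwards, once the test is finished, executed in $p_j$ time units; other tasks may run between the test and the execution, and the test and the execution of a job may be on different machines. The completion time of a job is the time at which its execution (or execution-untested) ends, and the cost of a schedule is the sum of the completion times of all jobs. An online algorithm knows all $t_j,u_j$ from the start, but learns $p_j$ only when the test of $j$ is finished. $\mathrm{OPT}$ knows all $p_j$ in advance (but must still test $j$ in order to run it in time $p_j$), and its cost is the minimum cost of any schedule; it spends $p_j^*=\min\{u_j,t_j+p_j\}$ on job $j$ and runs jobs in non-decreasing order of $p_j^*$ whenever a machine is available. The expected competitive ratio of a randomized online algorithm $A$ is the smallest $c$ such that $\mathbb E[\mathrm{cost}(A)]\le c\cdot\mathrm{cost}(\mathrm{OPT})$ on all instances. Algorithm $\beta$-RPCPM. The testing probability $\mathbb P_j\in[0,1]$ of job $j$ is a function of $u_j,t_j,\beta$, with $\mathbb P_j=0$ if $u_j/t_j<1$ and $\mathbb P_j=1$ if $u_j/t_j>3$. Maintain a priority queue of tasks, smaller weight meaning higher priority (ties broken arbitrarily). Initially, for each job $j$, independently: with probability $\mathbb P_j$ insert a testing task of weight $\beta t_j$ (job $j$ is tested), and with probability $1-\mathbb P_j$ insert an execution-untested task of weight $u_j$ (job $j$ is not tested). All machines are idle at time $0$. Whenever a machine becomes idle: if the task it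 has just finished was the testing task of a job $i$, insert the execution task of $i$ (of duration $p_i$) with weight $t_i+p_i$ into the queue; then extract a task of smallest weight from the queue (if it is nonempty) and run it, without interruption, on this machine. -}

module Defs where

open import Algebra.Bundles using (CommutativeRing)
open import Algebra.Structures using (IsCommutativeRing)
import Algebra.Construct.NaturalChoice.Max as NaturalMax
import Algebra.Construct.NaturalChoice.Min as NaturalMin
import Algebra.Definitions.RawMonoid as RawMonoidDefinitions
open import Data.Bool.Base using (Bool; true; false; if_then_else_; T; not)
open import Data.Fin.Base using (Fin)
open import Data.List.Base as List using (List; []; _∷_; _++_)
open import Data.List.Relation.Binary.Permutation.Propositional using (_↭_)
open import Data.List.Relation.Unary.All using (All)
open import Data.Maybe.Base using (Maybe; just; nothing)
open import Data.Nat.Base as ℕ using (ℕ; NonZero)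
open import Data.Product.Base using (_×_; ∃-syntax)
open import Data.Sum.Base using (_⊎_)
open import Data.Vec.Base as Vec using (Vec; []; _∷_; lookup; _[_]≔_)
open import Level using (Level; _⊔_) renaming (suc to lsuc)
open import Relation.Binary.Bundles using (DecTotalOrder)
open import Relation.Binary.Construct.Closure.ReflexiveTransitive using (Star)
import Relation.Binary.Construct.NonStrictToStrict as NonStrictToStrict
open import Relation.Binary.Core using (Rel)
open import Relation.Binary.PropositionalEquality.Core using (_≡_; _≢_)
open import Relation.Binary.Structures using (IsDecTotalOrder)

-- Linearly ordered fields; the real numbers are the intended instance.
record OrderedField c ℓ : Set (lsuc (c ⊔ ℓ)) where
  infix  8 _⁻¹ -_
  infixl 7 _*_ _/_
  infixl 6 _+_ _-_
  infix  4 _≤_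
  field
    Carrier           : Set c
    _≤_               : Rel Carrier ℓ
    _+_ _*_           : Carrier → Carrier → Carrier
    -_ _⁻¹            : Carrier → Carrier
    0# 1#             : Carrier
    isCommutativeRing : IsCommutativeRing _≡_ _+_ _*_ -_ 0# 1#
    0≢1               : 0# ≢ 1#
    -- The value of 0# ⁻¹ is left unspecified.
    *-inverseʳ        : ∀ x → x ≢ 0# → x * x ⁻¹ ≡ 1#
    isDecTotalOrder   : IsDecTotalOrder _≡_ _≤_
    +-monoʳ-≤         : ∀ x {y z} → y ≤ z → x + y ≤ x + z
    *-nonNeg          : ∀ {x y} → 0# ≤ x → 0# ≤ y → 0# ≤ x * y

  commutativeRing : CommutativeRing c c
  commutativeRing = record { isCommutativeRing = isCommutativeRing }

  decTotalOrder : DecTotalOrder c c ℓ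
  decTotalOrder = record { isDecTotalOrder = isDecTotalOrder }

  open NonStrictToStrict _≡_ _≤_ public using (_<_)
  open NaturalMax (DecTotalOrder.totalOrder decTotalOrder) public
    using () renaming (_⊔_ to max)
  open NaturalMin (DecTotalOrder.totalOrder decTotalOrder) public
    using () renaming (_⊓_ to min)
  open RawMonoidDefinitions (CommutativeRing.+-rawMonoid commutativeRing) public
    using (sum) renaming (_×_ to _×ℕ_)

  _-_ _/_ : Carrier → Carrier → Carrier
  x - y = x + - y
  x / y = x * y ⁻¹

  fromℕ : ℕ → Carrier
  fromℕ n = n ×ℕ 1#

  IsSupremum : ∀ {a} {A : Set a} → (A → Carrier) → Carrier → Set (a ⊔ c ⊔ ℓ)
  IsSupremum f s = (∀ x → f x ≤ s) × (∀ b → (∀ x → f x ≤ b) → s ≤ b)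

module Scheduling {c ℓ} (F : OrderedField c ℓ) where
  open OrderedField F

  record Job : Set (c ⊔ ℓ) where
    field
      t u p : Carrier
      0<t   : 0# < t
      0<u   : 0# < u
      0≤p   : 0# ≤ p
      p≤u   : p ≤ u

    p* : Carrier
    p* = min u (t + p)

  open Job

  Instance : ℕ → Set (c ⊔ ℓ)
  Instance n = Fin n → Job

  data Task (n : ℕ) : Set where
    test execute untested : Fin n → Task n

  duration : ∀ {n} → Instance n → Task n → Carrier
  duration I (test j)     = t (I j)
  duration I (execute j)  = p (I j)
  duration I (untested j) = u (I j)

  ----------------------------------------------------------------------
  -- Offline schedules

  IsPerformed : ∀ {n} → (Fin n → Bool) → Task n → Set
  IsPerformed tested (test j)     = T (tested j)
  IsPerformed tested (execute j)  = T (tested j)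
  IsPerformed tested (untested j) = T (not (tested j))

  -- The values of machine and start on tasks that are not performed are
  -- irrelevant.
  record Schedule (m : ℕ) {n : ℕ} (I : Instance n) : Set (c ⊔ ℓ) where
    field
      tested  : Fin n → Bool
      machine : Task n → Fin m
      start   : Task n → Carrier

    end : Task n → Carrier
    end a = start a + duration I a

    field
      start≥0    : ∀ a → IsPerformed tested a → 0# ≤ start a
      test-first : ∀ j → T (tested j) → end (test j) ≤ start (execute j)
      no-overlap : ∀ a b → IsPerformed tested a → IsPerformed tested b →
                   a ≢ b → machine a ≡ machine b →
                   end a ≤ start b ⊎ end b ≤ start a

    completion : Fin n → Carrier
    completion j = if tested j then end (execute j) else end (untested j)

    cost : Carrier
    cost = sum completion

  IsOptCost : ∀ (m : ℕ) {n} → Instance n → Carrier → Set (c ⊔ ℓ)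
  IsOptCost m I o =
    (∃[ S ] Schedule.cost {m} {I = I} S ≡ o) ×
    (∀ (S : Schedule m I) → o ≤ Schedule.cost S)

  ----------------------------------------------------------------------
  -- The algorithm β-RPCPM

  record TestingRule : Set (c ⊔ ℓ) where
    field
      prob   : (t u : Carrier) → Carrier
      prob≥0 : ∀ {t u} → 0# < t → 0# < u → 0# ≤ prob t u
      prob≤1 : ∀ {t u} → 0# < t → 0# < u → prob t u ≤ 1#
      prob≡0 : ∀ {t u} → 0# < t → 0# < u → u / t < 1# → prob t u ≡ 0#
      prob≡1 : ∀ {t u} → 0# < t → 0# < u → fromℕ 3 < u / t → prob t u ≡ 1#

    ℙ : Job → Carrier
    ℙ j = prob (t j) (u j)

  open TestingRule public using (ℙ)

  -- busy x f: running until time f, where x is the task being run.  The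
  -- case x = nothing only serves to let every machine become idle at time 0
  -- without having finished a task.  A machine is idle if it became idle
  -- while the queue was empty; it then never runs another task.
  data Machine (n : ℕ) : Set c where
    busy : Maybe (Task n) → Carrier → Machine n
    idle : Machine n

  -- total is the sum of the completion times of the jobs completed so far.
  record State (m n : ℕ) : Set c where
    constructor ⟨_,_,_⟩
    field
      machines : Vec (Machine n) m
      queue    : List (Task n)
      total    : Carrier

  module RPCPM (m : ℕ) (β : Carrier) {n : ℕ} (I : Instance n) where

    weight : Task n → Carrier
    weight (test j)     = β * t (I j)
    weight (execute j)  = t (I j) + p (I j)
    weight (untested j) = u (I j)

    released : Maybe (Task n) → List (Task n)
    released (just (test j)) = execute j ∷ []
    released _               = []

    -- The contribution to the cost of a task finishing at time f.
    completed : Maybe (Task n) → Carrier → Carrier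
    completed (just (execute j))  f = f
    completed (just (untested j)) f = f
    completed _                   f = 0#

    -- Machine i is one of those that become idle next, at time f, having
    -- finished x.
    BecomesIdle : Vec (Machine n) m → Fin m → Maybe (Task n) → Carrier →
                  Set (c ⊔ ℓ)
    BecomesIdle M i x f =
      lookup M i ≡ busy x f ×
      (∀ k {y g} → lookup M k ≡ busy y g → f ≤ g)

    infix 4 _⟶_

    -- Ties, both between tasks of equal weight and between machines
    -- becoming idle simultaneously, are resolved nondeterministically.
    data _⟶_ : State m n → State m n → Set (c ⊔ ℓ) where
      run  : ∀ {M Q C i x f a Q′} →
             BecomesIdle M i x f →
             released x ++ Q ↭ a ∷ Q′ →
             All (λ b → weight a ≤ weight b) Q′ →
             ⟨ M , Q , C ⟩ ⟶
             ⟨ M [ i ]≔ busy (just a) (f + duration I a) , Q′ , C + completed x f ⟩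
      stop : ∀ {M Q C i x f} →
             BecomesIdle M i x f →
             released x ++ Q ≡ [] →
             ⟨ M , Q , C ⟩ ⟶ ⟨ M [ i ]≔ idle , [] , C + completed x f ⟩

    -- The coins record which jobs are tested.
    initialTask : Vec Bool n → Fin n → Task n
    initialTask coins j = if lookup coins j then test j else untested j

    initial : Vec Bool n → State m n
    initial coins =
      ⟨ Vec.replicate m (busy nothing 0#) , List.tabulate (initialTask coins) , 0# ⟩

    final : Carrier → State m n
    final C = ⟨ Vec.replicate m idle , [] , C ⟩

    IsCost : Vec Bool n → Carrier → Set (c ⊔ ℓ)
    IsCost coins C = Star _⟶_ (initial coins) (final C)

  -- The expectation of f when the coordinates of its argument are
  -- independent and the j-th one is true with probability q j.
  𝔼 : ∀ {n} → (Fin n → Carrier) → (Vec Bool n → Carrier) → Carrier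
  𝔼 {ℕ.zero}  q f = f []
  𝔼 {ℕ.suc n} q f =
    q Fin.zero * 𝔼 (λ j → q (Fin.suc j)) (λ v → f (true ∷ v)) +
    (1# - q Fin.zero) * 𝔼 (λ j → q (Fin.suc j)) (λ v → f (false ∷ v))

  -- e is an expected cost of the algorithm on I, for some way of breaking
  -- ties (which may differ between outcomes of the coins).
  IsExpectedCost : ∀ (m : ℕ) (β : Carrier) (P : TestingRule) {n} →
                   Instance n → Carrier → Set (c ⊔ ℓ)
  IsExpectedCost m β P {n} I e =
    ∃[ cost ] (∀ coins → RPCPM.IsCost m β I coins (cost coins)) ×
              e ≡ 𝔼 (λ j → ℙ P (I j)) cost

  ExpectedCompetitiveRatioAtMost : (m : ℕ) (β : Carrier) (P : TestingRule) →
                                   Carrier → Set (c ⊔ ℓ)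
  ExpectedCompetitiveRatioAtMost m β P ρ =
    ∀ {n} (I : Instance n) {e o} →
    IsExpectedCost m β P I e → IsOptCost m I o → e ≤ ρ * o

  R-ratio : (β : Carrier) → TestingRule → Job → Carrier
  R-ratio β P k =
    ( (1# + 1# / β) * u k * (1# - ℙ P k)
    + max (max (fromℕ 2 * t k + p k) (β * t k)) ((1# + 1# / β) * (t k + p k)) * ℙ P k
    ) / p* k

  r-ratio : TestingRule → Job → Carrier
  r-ratio P j = (u j * (1# - ℙ P j) + (t j + p j) * ℙ P j) / p* j

{-# OPTIONS --safe #-}
-- With N the sum of min (p* j) (p* k) over all ordered pairs (j, k):
--   2 m cost(OPT) ≥ N + m Σ p*   and
--   2 m E[cost]   ≤ R (N + Σ p*) + 2 (m - 1) r Σ p*;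
-- since cost(OPT) ≥ Σ p* and R ≤ 2 r, these combine to the ratio.
--
-- OPT.  Let every task of a job have density 1 / (work spent on the job).  The
-- mean busy time of a job is at most its completion time minus half its work.  On
-- a single machine the total of the mean busy times is at least half the
-- quadratic form of the kernel min (κ a) (κ b) in the durations, κ being the
-- density, and since that kernel is positive semidefinite, distributing the work
-- over m machines divides the form by at most m.
--
-- Algorithm.  Call a tested job prompt from the moment a task heavier than its
-- execution is started after its test.  The queue then contains, and will only
-- contain, heavier tasks, so the execution of the job starts as soon as its test
-- ends.  Hence the completion time of k is at most its own work plus 1/m times
-- the work on the other jobs started before k is prompt or started for good.
-- Comparing weights, the delays that j causes k and k causes j add up to at most
-- the term of the numerator of R at k that belongs to the outcome for k, and, by
-- symmetry, to at most that term at the job with the smaller p*.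
module Submission where

open import Defs
open import Algebra.Bundles using (CommutativeRing)
import Algebra.Construct.NaturalChoice.Max as NaturalMax
import Algebra.Construct.NaturalChoice.Min as NaturalMin
import Algebra.Solver.Ring as RingSolver
open import Algebra.Solver.Ring.AlmostCommutativeRing
  using (fromCommutativeRing; _-Raw-AlmostCommutative⟶_)
open import Data.Bool.Base using (Bool; true; false; if_then_else_)
open import Data.Empty using (⊥; ⊥-elim)
open import Data.Fin.Base using (Fin; zero; suc; punchIn)
import Data.Fin.Properties as Fin
open import Data.Integer.Base as ℤ using (ℤ; -[1+_])
import Data.Integer.Properties as ℤ
open import Data.List.Base using (List; []; _∷_; _++_; tabulate; lookup; length; map; allFin)
import Data.List.Extrema as Extrema
open import Data.List.Membership.Propositional using (_∈_)
open import Data.List.Membership.Propositional.Properties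
  using (∈-allFin; ∈-lookup; ∈-tabulate⁺; ∈-tabulate⁻; ∈-++⁻; ∈-++⁺ˡ; ∈-++⁺ʳ; ∈-map⁺)
open import Data.List.Properties using (map-tabulate; tabulate-cong; ++-identityʳ; ++-conicalʳ)
open import Data.List.Relation.Binary.Permutation.Propositional as Perm
  using (_↭_; ↭-refl; ↭-sym; ↭-trans; ↭-reflexive; ↭⇒↭ₛ)
open import Data.List.Relation.Binary.Permutation.Propositional.Properties
  using (All-resp-↭; ∈-resp-↭; map⁺; ++⁺ˡ; ++⁺ʳ; shift; shifts; drop-∷)
import Data.List.Relation.Binary.Permutation.Setoid.Properties as PermSetoid
open import Data.List.Relation.Unary.All as All using (All; []; _∷_)
open import Data.List.Relation.Unary.AllPairs using (_∷_)
open import Data.List.Relation.Unary.Any using (here; there)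
open import Data.List.Relation.Unary.Unique.Propositional using (Unique)
import Data.List.Relation.Unary.Unique.Propositional.Properties as Unique
open import Data.Maybe.Base as Maybe using (just; nothing)
open import Data.Nat.Base as ℕ using (ℕ; zero; suc; NonZero)
import Data.Nat.Properties as ℕ
open import Data.Product.Base using (_×_; _,_; proj₁; proj₂; ∃; ∃-syntax)
open import Data.Sum.Base using (_⊎_; inj₁; inj₂; [_,_]′)
open import Data.Unit.Base using (⊤; tt)
open import Data.Vec.Base as Vec using (Vec; []; _∷_; _[_]≔_)
open import Data.Vec.Properties using ([]≔-lookup; lookup∘update; lookup∘update′; lookup-replicate)
open import Level using (_⊔_)
open import Relation.Binary.Bundles using (DecTotalOrder)
open import Relation.Binary.Construct.Closure.ReflexiveTransitive using (Star; ε; _◅_)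
open import Relation.Binary.PropositionalEquality
open import Relation.Nullary using (Dec; yes; no; ¬_; contradiction)
open import Relation.Nullary.Decidable using (does; dec⇒maybe)

-- Arithmetic in an ordered field and finite sums.

module Arithmetic {c ℓ} (F : OrderedField c ℓ) where
  open OrderedField F
  open CommutativeRing commutativeRing public
    using ( +-assoc; +-comm; +-identityˡ; +-identityʳ; *-comm; *-identityˡ; *-identityʳ; zeroˡ; zeroʳ
          ; -‿inverseʳ; -‿inverseˡ; ring; semiring)
  open DecTotalOrder decTotalOrder public
    using (_≟_; _≤?_; totalOrder)
    renaming (refl to ≤-refl; reflexive to ≤-reflexive; trans to ≤-trans; antisym to ≤-antisym; total to
        ≤-total)
  open import Algebra.Properties.Ring ring using (-0#≈0#; -‿distribˡ-*; -‿distribʳ-*; -‿involutive; -‿+-comm)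
  open import Algebra.Properties.Semiring.Mult semiring using (×1-homo-*; ×-homo-+)

  -- Interprets the integer coefficients of the ring solver; decidable equality of integers lets it
  -- collect and cancel numerals. The separate clause for 1 makes the literal `con (ℤ.+ 1)` unfold
  -- to `1#` itself, whereas `fromℕ 1` is `1# + 0#`.
  fromℤ : ℤ → Carrier
  fromℤ (ℤ.+ 1)    = 1#
  fromℤ (ℤ.+ n)    = fromℕ n
  fromℤ -[1+ n ] = - fromℕ (suc n)

  fromℤ-+ : ∀ n → fromℤ (ℤ.+ n) ≡ fromℕ n
  fromℤ-+ 0 = refl
  fromℤ-+ 1 = sym (+-identityʳ 1#)
  fromℤ-+ (suc (suc n)) = refl

  fromℤ-neg : ∀ i → fromℤ (ℤ.- i) ≡ - fromℤ i
  fromℤ-neg (ℤ.+ 0)           = sym -0#≈0#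
  fromℤ-neg (ℤ.+ 1)           = cong -_ (+-identityʳ 1#)
  fromℤ-neg (ℤ.+ suc (suc n)) = refl
  fromℤ-neg -[1+ n ]        = trans (fromℤ-+ (suc n)) (sym (-‿involutive _))

  +-cancel-one : ∀ x y → (1# + x) + - (1# + y) ≡ x + - y
  +-cancel-one x y = begin
    (1# + x) + - (1# + y)     ≡⟨ cong (1# + x +_) (sym (-‿+-comm 1# y)) ⟩
    (1# + x) + (- 1# + - y)   ≡⟨ cong (_+ (- 1# + - y)) (+-comm 1# x) ⟩
    (x + 1#) + (- 1# + - y)   ≡⟨ +-assoc x 1# _ ⟩
    x + (1# + (- 1# + - y))   ≡⟨ cong (x +_) (sym (+-assoc 1# (- 1#) (- y))) ⟩
    x + ((1# + - 1#) + - y)   ≡⟨ cong (λ z → x + (z + - y)) (-‿inverseʳ 1#) ⟩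
    x + (0# + - y)            ≡⟨ cong (x +_) (+-identityˡ (- y)) ⟩
    x + - y                   ∎
    where
    open ≡-Reasoning

  fromℤ-⊖ : ∀ m n → fromℤ (m ℤ.⊖ n) ≡ fromℕ m - fromℕ n
  fromℤ-⊖ m       zero    = trans (fromℤ-+ m) (sym (trans (cong (fromℕ m +_) -0#≈0#) (+-identityʳ _)))
  fromℤ-⊖ zero    (suc n) = sym (+-identityˡ _)
  fromℤ-⊖ (suc m) (suc n) = trans (cong fromℤ (ℤ.[1+m]⊖[1+n]≡m⊖n m n))
    (trans (fromℤ-⊖ m n) (sym (+-cancel-one _ _)))

  fromℤ-+-homo : ∀ i j → fromℤ (i ℤ.+ j) ≡ fromℤ i + fromℤ j
  fromℤ-+-homo (ℤ.+ m) (ℤ.+ n) = trans (fromℤ-+ (m ℕ.+ n))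
    (trans (×-homo-+ 1# m n) (sym (cong₂ _+_ (fromℤ-+ m) (fromℤ-+ n))))
  fromℤ-+-homo (ℤ.+ m) -[1+ n ] = trans (fromℤ-⊖ m (suc n)) (cong (_- _) (sym (fromℤ-+ m)))
  fromℤ-+-homo -[1+ m ] (ℤ.+ n) = trans (fromℤ-⊖ n (suc m))
    (trans (cong (_- _) (sym (fromℤ-+ n))) (+-comm _ _))
  fromℤ-+-homo -[1+ m ] -[1+ n ] = trans
    (cong -_ (trans (cong (λ k → fromℕ (suc k)) (sym (ℕ.+-suc m n))) (×-homo-+ 1# (suc m) (suc n))))
    (sym (-‿+-comm _ _))

  fromℤ-*-+ : ∀ m n → fromℤ (ℤ.+ m ℤ.* ℤ.+ n) ≡ fromℤ (ℤ.+ m) * fromℤ (ℤ.+ n)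
  fromℤ-*-+ m n = begin
    fromℤ (ℤ.+ m ℤ.* ℤ.+ n)        ≡⟨ cong fromℤ (sym (ℤ.pos-* m n)) ⟩
    fromℤ (ℤ.+ (m ℕ.* n))        ≡⟨ fromℤ-+ (m ℕ.* n) ⟩
    fromℕ (m ℕ.* n)            ≡⟨ ×1-homo-* m n ⟩
    fromℕ m * fromℕ n          ≡⟨ cong₂ _*_ (sym (fromℤ-+ m)) (sym (fromℤ-+ n)) ⟩
    fromℤ (ℤ.+ m) * fromℤ (ℤ.+ n)  ∎
    where open ≡-Reasoning

  fromℤ-*-homoʳ : ∀ i n → fromℤ (i ℤ.* ℤ.+ n) ≡ fromℤ i * fromℤ (ℤ.+ n)
  fromℤ-*-homoʳ (ℤ.+ m)  n = fromℤ-*-+ m n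
  fromℤ-*-homoʳ -[1+ m ] n = begin
    fromℤ (-[1+ m ] ℤ.* ℤ.+ n)             ≡⟨ cong fromℤ (sym (ℤ.neg-distribˡ-* (ℤ.+ suc m) (ℤ.+ n))) ⟩
    fromℤ (ℤ.- (ℤ.+ suc m ℤ.* ℤ.+ n))      ≡⟨ fromℤ-neg (ℤ.+ suc m ℤ.* ℤ.+ n) ⟩
    - fromℤ (ℤ.+ suc m ℤ.* ℤ.+ n)          ≡⟨ cong -_ (fromℤ-*-+ (suc m) n) ⟩
    - (fromℤ (ℤ.+ suc m) * fromℤ (ℤ.+ n))  ≡⟨ -‿distribˡ-* _ _ ⟩
    - fromℤ (ℤ.+ suc m) * fromℤ (ℤ.+ n)    ≡⟨ cong (_* fromℤ (ℤ.+ n)) (sym (fromℤ-neg (ℤ.+ suc m))) ⟩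
    fromℤ -[1+ m ] * fromℤ (ℤ.+ n)         ∎
    where open ≡-Reasoning

  fromℤ-*-homo : ∀ i j → fromℤ (i ℤ.* j) ≡ fromℤ i * fromℤ j
  fromℤ-*-homo i (ℤ.+ n)  = fromℤ-*-homoʳ i n
  fromℤ-*-homo i -[1+ n ] = begin
    fromℤ (i ℤ.* -[1+ n ])              ≡⟨ cong fromℤ (sym (ℤ.neg-distribʳ-* i (ℤ.+ suc n))) ⟩
    fromℤ (ℤ.- (i ℤ.* ℤ.+ suc n))       ≡⟨ fromℤ-neg (i ℤ.* ℤ.+ suc n) ⟩
    - fromℤ (i ℤ.* ℤ.+ suc n)           ≡⟨ cong -_ (fromℤ-*-homoʳ i (suc n)) ⟩
    - (fromℤ i * fromℤ (ℤ.+ suc n))     ≡⟨ -‿distribʳ-* _ _ ⟩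
    fromℤ i * - fromℤ (ℤ.+ suc n)       ≡⟨ cong (fromℤ i *_) (sym (fromℤ-neg (ℤ.+ suc n))) ⟩
    fromℤ i * fromℤ -[1+ n ]            ∎
    where open ≡-Reasoning

  fromℤ-homomorphism : ℤ.+-*-rawRing -Raw-AlmostCommutative⟶ fromCommutativeRing commutativeRing
  fromℤ-homomorphism = record
    { ⟦_⟧    = fromℤ
    ; +-homo = fromℤ-+-homo
    ; *-homo = fromℤ-*-homo
    ; -‿homo = fromℤ-neg
    ; 0-homo = refl
    ; 1-homo = refl
    }

  open RingSolver ℤ.+-*-rawRing (fromCommutativeRing commutativeRing) fromℤ-homomorphism
    (λ i j → Maybe.map (cong fromℤ) (dec⇒maybe (i ℤ.≟ j))) public
    using (solve; _:+_; _:*_; _:-_; :-_; con; _:=_)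

  -- Many inequalities below are proved by exhibiting their slack `s`; the remaining identity is
  -- left to the ring solver.
  ≤-by : ∀ {a b} s → 0# ≤ s → b ≡ a + s → a ≤ b
  ≤-by {a} s 0≤s refl = subst (_≤ a + s) (+-identityʳ a) (+-monoʳ-≤ a 0≤s)

  0≤-difference : ∀ {a b} → a ≤ b → 0# ≤ b - a
  0≤-difference {a} {b} a≤b = subst₂ _≤_ (-‿inverseˡ a) (+-comm (- a) b) (+-monoʳ-≤ (- a) a≤b)

  ≤-from : ∀ {x y a b} → x ≤ y → b - a ≡ y - x → a ≤ b
  ≤-from {x} {y} {a} {b} x≤y eq = ≤-by (b - a) (subst (0# ≤_) (sym eq) (0≤-difference x≤y))
    (solve 2 (λ a b → b := a :+ (b :- a)) refl a b)

  +-mono-≤ : ∀ {a b x y} → a ≤ b → x ≤ y → a + x ≤ b + y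
  +-mono-≤ {a} {b} {x} {y} a≤b x≤y =
    ≤-trans (+-monoʳ-≤ a x≤y) (subst₂ _≤_ (+-comm y a) (+-comm y b) (+-monoʳ-≤ y a≤b))

  +-nonNeg : ∀ {a b} → 0# ≤ a → 0# ≤ b → 0# ≤ a + b
  +-nonNeg 0≤a 0≤b = subst (_≤ _) (+-identityˡ 0#) (+-mono-≤ 0≤a 0≤b)

  x≤x+y : ∀ {x y} → 0# ≤ y → x ≤ x + y
  x≤x+y {x} {y} 0≤y = ≤-by y 0≤y refl

  *-monoˡ-≤ : ∀ {z x y} → 0# ≤ z → x ≤ y → z * x ≤ z * y
  *-monoˡ-≤ {z} {x} {y} 0≤z x≤y = ≤-by (z * (y - x)) (*-nonNeg 0≤z (0≤-difference x≤y))
    (solve 3 (λ x y z → z :* y := z :* x :+ z :* (y :- x)) refl x y z)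

  *-monoʳ-≤ : ∀ {z x y} → 0# ≤ z → x ≤ y → x * z ≤ y * z
  *-monoʳ-≤ {z} {x} {y} 0≤z x≤y = subst₂ _≤_ (*-comm z x) (*-comm z y) (*-monoˡ-≤ 0≤z x≤y)

  square-nonNeg : ∀ x → 0# ≤ x * x
  square-nonNeg x with ≤-total 0# x
  ... | inj₁ 0≤x = *-nonNeg 0≤x 0≤x
  ... | inj₂ x≤0 = subst (0# ≤_) (solve 1 (λ x → (con (ℤ.+ 0) :- x) :* (con (ℤ.+ 0) :- x) := x :* x) refl x)
    (*-nonNeg (0≤-difference x≤0) (0≤-difference x≤0))

  0≤1 : 0# ≤ 1#
  0≤1 = subst (0# ≤_) (*-identityˡ 1#) (square-nonNeg 1#)

  fromℕ-nonNeg : ∀ n → 0# ≤ fromℕ n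
  fromℕ-nonNeg zero    = ≤-refl
  fromℕ-nonNeg (suc n) = +-nonNeg 0≤1 (fromℕ-nonNeg n)

  <-≤-trans : ∀ {x y z} → x < y → y ≤ z → x < z
  <-≤-trans (x≤y , x≢y) y≤z = ≤-trans x≤y y≤z , λ { refl → x≢y (≤-antisym x≤y y≤z) }

  ≰⇒> : ∀ {x y} → ¬ (x ≤ y) → y < x
  ≰⇒> {x} {y} x≰y with ≤-total x y
  ... | inj₁ x≤y = contradiction x≤y x≰y
  ... | inj₂ y≤x = y≤x , λ { refl → x≰y ≤-refl }

  <⇒≱ : ∀ {x y} → x < y → ¬ (y ≤ x)
  <⇒≱ (x≤y , x≢y) y≤x = x≢y (≤-antisym x≤y y≤x)

  0<fromℕ : ∀ n .{{_ : NonZero n}} → 0# < fromℕ n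
  0<fromℕ (suc n) = <-≤-trans (0≤1 , 0≢1) (x≤x+y (fromℕ-nonNeg n))

  1≤fromℕ : ∀ n .{{_ : NonZero n}} → 1# ≤ fromℕ n
  1≤fromℕ (suc n) = x≤x+y (fromℕ-nonNeg n)

  *-inverse : ∀ {x} → 0# < x → x * x ⁻¹ ≡ 1#
  *-inverse (_ , 0≢x) = *-inverseʳ _ (λ x≡0 → 0≢x (sym x≡0))

  -- The inverse is `x` times its own square.
  ⁻¹-nonNeg : ∀ {x} → 0# < x → 0# ≤ x ⁻¹
  ⁻¹-nonNeg {x} 0<x = subst (0# ≤_)
    (trans (solve 2 (λ x y → x :* (y :* y) := (x :* y) :* y) refl x (x ⁻¹))
      (trans (cong (_* x ⁻¹) (*-inverse 0<x)) (*-identityˡ _)))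
    (*-nonNeg (proj₁ 0<x) (square-nonNeg (x ⁻¹)))

  *-cancelˡ-≤ : ∀ {x y z} → 0# < z → z * x ≤ z * y → x ≤ y
  *-cancelˡ-≤ {x} {y} {z} 0<z zx≤zy = subst₂ _≤_ (cancel x) (cancel y) (*-monoˡ-≤ (⁻¹-nonNeg 0<z) zx≤zy)
    where
    cancel : ∀ w → z ⁻¹ * (z * w) ≡ w
    cancel w = trans (solve 3 (λ z i w → i :* (z :* w) := (z :* i) :* w) refl z (z ⁻¹) w)
      (trans (cong (_* w) (*-inverse 0<z)) (*-identityˡ w))

  /-cancel : ∀ {x y} → 0# < y → x / y * y ≡ x
  /-cancel {x} {y} 0<y = trans (solve 3 (λ x y i → x :* i :* y := x :* (y :* i)) refl x y (y ⁻¹))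
    (trans (cong (x *_) (*-inverse 0<y)) (*-identityʳ x))

  x/y≤z⇒x≤z*y : ∀ {x y z} → 0# < y → x / y ≤ z → x ≤ z * y
  x/y≤z⇒x≤z*y {x} {y} 0<y x/y≤z = subst (_≤ _) (/-cancel 0<y) (*-monoʳ-≤ (proj₁ 0<y) x/y≤z)

  open NaturalMin totalOrder public using ()
    renaming ( x⊓y≤x to min≤ˡ; x⊓y≤y to min≤ʳ; ⊓-sel to min-sel; ⊓-comm to min-comm
             ; x≤y⇒x⊓y≈x to min-≤; x≤y⇒y⊓x≈x to min-≥)
  open NaturalMax totalOrder public using ()
    renaming (x≤x⊔y to max≥ˡ; x≤y⊔x to max≥ʳ)

  open import Algebra.Properties.Semiring.Sum semiring public
    using (sum-cong-≗; sum-remove; ∑-distrib-+; ∑-comm; *-distribˡ-sum; sum-replicate-zero)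

  sum-mono-≤ : ∀ {n} {f g : Fin n → Carrier} → (∀ i → f i ≤ g i) → sum f ≤ sum g
  sum-mono-≤ {zero}  f≤g = ≤-refl
  sum-mono-≤ {suc n} f≤g = +-mono-≤ (f≤g zero) (sum-mono-≤ (λ i → f≤g (suc i)))

  sum-nonNeg : ∀ {n} {f : Fin n → Carrier} → (∀ i → 0# ≤ f i) → 0# ≤ sum f
  sum-nonNeg {n} {f} 0≤f = subst (_≤ sum f) (sum-replicate-zero n) (sum-mono-≤ 0≤f)

  sum-constant : ∀ n x → sum {n} (λ _ → x) ≡ fromℕ n * x
  sum-constant zero    x = sym (zeroˡ x)
  sum-constant (suc n) x = trans (cong (x +_) (sum-constant n x))
    (solve 2 (λ x n → x :+ n :* x := (con (ℤ.+ 1) :+ n) :* x) refl x (fromℕ n))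

  sum-mono-≤-at : ∀ {n} {f g : Fin n → Carrier} i d →
    f i + d ≤ g i → (∀ j → j ≢ i → f j ≤ g j) → sum f + d ≤ sum g
  sum-mono-≤-at {suc n} {f} {g} i d fi+d≤gi f≤g = subst₂ _≤_
    (trans (solve 3 (λ x y d → x :+ d :+ y := x :+ y :+ d) refl (f i) (sum (λ j → f (punchIn i j))) d)
      (cong (_+ d) (sym (sum-remove f))))
    (sym (sum-remove g))
    (+-mono-≤ fi+d≤gi (sum-mono-≤ (λ j → f≤g (punchIn i j) (Fin.punchInᵢ≢i i j))))

  sum-increment : ∀ {n} {f g : Fin n → Carrier} i d →
    g i ≡ f i + d → (∀ j → j ≢ i → g j ≡ f j) → sum g ≡ sum f + d
  sum-increment {suc n} {f} {g} i d gi≡ g≡f = begin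
    sum g                                       ≡⟨ sum-remove g ⟩
    g i + sum (λ j → g (punchIn i j))           ≡⟨ cong₂ _+_ gi≡
        (sum-cong-≗ (λ j → g≡f (punchIn i j) (Fin.punchInᵢ≢i i j))) ⟩
    f i + d + sum (λ j → f (punchIn i j))       ≡⟨ solve 3 (λ x y d → x :+ d :+ y := x :+ y :+ d) refl
        (f i) _ d ⟩
    f i + sum (λ j → f (punchIn i j)) + d       ≡⟨ cong (_+ d) (sym (sum-remove f)) ⟩
    sum f + d                                   ∎
    where open ≡-Reasoning

-- The quadratic form of the kernel `min`, and disjoint intervals.

module QuadraticForms {c ℓ} (F : OrderedField c ℓ) where
  open OrderedField F
  open Arithmetic F
  open Extrema totalOrder using (argmin; argmax; f[argmin]≤f[xs]; f[xs]≤f[argmax])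

  minimiser : ∀ {n} (f : Fin (suc n) → Carrier) → ∃ λ i → ∀ j → f i ≤ f j
  minimiser f = argmin f zero (allFin _) , λ j → All.lookup (f[argmin]≤f[xs] zero (allFin _)) (∈-allFin j)

  maximiser : ∀ {n} (f : Fin (suc n) → Carrier) → ∃ λ i → ∀ j → f j ≤ f i
  maximiser f = argmax f zero (allFin _) , λ j → All.lookup (f[xs]≤f[argmax] zero (allFin _)) (∈-allFin j)

  sum-* : ∀ {n} x (f : Fin n → Carrier) → sum (λ i → x * f i) ≡ x * sum f
  sum-* x f = sym (*-distribˡ-sum x f)

  sum-product : ∀ {m n} (f : Fin m → Carrier) (g : Fin n → Carrier) →
    sum (λ i → sum (λ j → f i * g j)) ≡ sum f * sum g
  sum-product f g = begin
    sum (λ i → sum (λ j → f i * g j))  ≡⟨ sum-cong-≗ (λ i → trans (sum-* (f i) g) (*-comm (f i) (sum g))) ⟩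
    sum (λ i → sum g * f i)            ≡⟨ sum-* (sum g) f ⟩
    sum g * sum f                      ≡⟨ *-comm (sum g) (sum f) ⟩
    sum f * sum g                      ∎
    where open ≡-Reasoning

  ∑∑-remove : ∀ {n} i (f : Fin (suc n) → Fin (suc n) → Carrier) →
    sum (λ a → sum (f a)) ≡
    f i i + sum (λ b → f i (punchIn i b)) +
    (sum (λ a → f (punchIn i a) i) + sum (λ a → sum (λ b → f (punchIn i a) (punchIn i b))))
  ∑∑-remove i f = trans (sum-remove {i = i} (λ a → sum (f a))) (cong₂ _+_ (sum-remove {i = i} (f i))
    (trans (sum-cong-≗ (λ a → sum-remove {i = i} (f (punchIn i a))))
      (∑-distrib-+ (λ a → f (punchIn i a) i) (λ a → sum (λ b → f (punchIn i a) (punchIn i b))))))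

  Q : ∀ {n} → (Fin n → Carrier) → (Fin n → Carrier) → Carrier
  Q κ x = sum (λ a → sum (λ b → min (κ a) (κ b) * (x a * x b)))

  min-shift : ∀ x y z → min x y ≡ z + min (x - z) (y - z)
  min-shift x y z = [ left , right ]′ (≤-total x y)
    where
    left : x ≤ y → min x y ≡ z + min (x - z) (y - z)
    left x≤y = trans (min-≤ x≤y) (trans (solve 2 (λ x z → x := z :+ (x :- z)) refl x z)
      (cong (z +_) (sym (min-≤ (≤-from x≤y (solve 3 (λ x y z → y :- z :- (x :- z) := y :- x) refl x y z))))))
    right : y ≤ x → min x y ≡ z + min (x - z) (y - z)
    right y≤x = trans (min-≥ y≤x) (trans (solve 2 (λ y z → y := z :+ (y :- z)) refl y z)
      (cong (z +_) (sym (min-≥ (≤-from y≤x (solve 3 (λ x y z → x :- z :- (y :- z) := x :- y) refl x y z))))))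

  -- Subtracting the least density `κ i` from all densities lowers the kernel by `κ i` everywhere,
  -- which splits off `κ i` times the square of the total. In what remains, the row and the column
  -- of `i` vanish.
  Q-remove-min : ∀ {n} (κ x : Fin (suc n) → Carrier) i → (∀ j → κ i ≤ κ j) →
    Q κ x ≡ κ i * (sum x * sum x) + Q (λ a → κ (punchIn i a) - κ i) (λ a → x (punchIn i a))
  Q-remove-min {n} κ x i κᵢ≤ = begin
    Q κ x
      ≡⟨ ∑∑-remove i (λ a b → min (κ a) (κ b) * (x a * x b)) ⟩
    min k k * (x₀ * x₀) + sum (λ b → min k (κ′ b) * (x₀ * x′ b)) +
      (sum (λ a → min (κ′ a) k * (x′ a * x₀)) + Q κ′ x′)
      ≡⟨ cong₂ _+_ (cong₂ _+_ (cong (_* (x₀ * x₀)) (min-≤ ≤-refl)) row) (cong₂ _+_ column rest) ⟩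
    k * (x₀ * x₀) + k * (x₀ * X) + (k * (x₀ * X) + (k * (X * X) + Q (λ a → κ′ a - k) x′))
      ≡⟨ solve 4 (λ k x₀ X q → k :* (x₀ :* x₀) :+ k :* (x₀ :* X) :+ (k :* (x₀ :* X) :+ (k :* (X :* X) :+ q))
                  := k :* ((x₀ :+ X) :* (x₀ :+ X)) :+ q) refl k x₀ X (Q (λ a → κ′ a - k) x′) ⟩
    k * ((x₀ + X) * (x₀ + X)) + Q (λ a → κ′ a - k) x′
      ≡⟨ cong (λ s → k * (s * s) + Q (λ a → κ′ a - k) x′) (sym (sum-remove {i = i} x)) ⟩
    k * (sum x * sum x) + Q (λ a → κ′ a - k) x′
      ∎
    where
    open ≡-Reasoning
    k = κ i
    x₀ = x i
    κ′ x′ : Fin n → Carrier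
    κ′ a = κ (punchIn i a)
    x′ a = x (punchIn i a)
    X = sum x′
    row : sum (λ b → min k (κ′ b) * (x₀ * x′ b)) ≡ k * (x₀ * X)
    row = trans (sum-cong-≗ (λ b → trans (cong (_* (x₀ * x′ b)) (min-≤ (κᵢ≤ (punchIn i b))))
        (solve 3 (λ k x y → k :* (x :* y) := k :* x :* y) refl k x₀ (x′ b))))
      (trans (sum-* (k * x₀) x′) (solve 3 (λ k x y → k :* x :* y := k :* (x :* y)) refl k x₀ X))
    column : sum (λ a → min (κ′ a) k * (x′ a * x₀)) ≡ k * (x₀ * X)
    column = trans (sum-cong-≗ (λ a → cong₂ _*_ (min-comm (κ′ a) k) (*-comm (x′ a) x₀))) row
    rest : Q κ′ x′ ≡ k * (X * X) + Q (λ a → κ′ a - k) x′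
    rest = begin
      Q κ′ x′
        ≡⟨ sum-cong-≗ (λ a → sum-cong-≗ (λ b → trans (cong (_* (x′ a * x′ b)) (min-shift (κ′ a) (κ′ b) k))
             (solve 4 (λ k x y z → (k :+ z) :* (x :* y) := k :* x :* y :+ z :* (x :* y)) refl
               k (x′ a) (x′ b) (min (κ′ a - k) (κ′ b - k))))) ⟩
      sum (λ a → sum (λ b → k * x′ a * x′ b + min (κ′ a - k) (κ′ b - k) * (x′ a * x′ b)))
        ≡⟨ sum-cong-≗ (λ a → ∑-distrib-+ (λ b → k * x′ a * x′ b)
            (λ b → min (κ′ a - k) (κ′ b - k) * (x′ a * x′ b))) ⟩
      sum (λ a → sum (λ b → k * x′ a * x′ b) + sum (λ b → min (κ′ a - k) (κ′ b - k) * (x′ a * x′ b)))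
        ≡⟨ ∑-distrib-+ (λ a → sum (λ b → k * x′ a * x′ b))
            (λ a → sum (λ b → min (κ′ a - k) (κ′ b - k) * (x′ a * x′ b))) ⟩
      sum (λ a → sum (λ b → k * x′ a * x′ b)) + Q (λ a → κ′ a - k) x′
        ≡⟨ cong (_+ Q (λ a → κ′ a - k) x′) (trans (sum-product (λ a → k * x′ a) x′)
             (trans (cong (_* X) (sum-* k x′)) (solve 2 (λ k x → k :* x :* x := k :* (x :* x)) refl k X))) ⟩
      k * (X * X) + Q (λ a → κ′ a - k) x′
        ∎

  -- Cauchy-Schwarz against the all-ones vector. A further entry `a` enlarges the slack by the sum
  -- of the squares of `a - x′ i`.
  square-sum-≤ : ∀ {m} (x : Fin m → Carrier) → sum x * sum x ≤ fromℕ m * sum (λ i → x i * x i)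
  square-sum-≤ {zero}  x = ≤-reflexive refl
  square-sum-≤ {suc m} x = ≤-by _ (+-nonNeg (0≤-difference (square-sum-≤ x′)) spread)
    (solve 4 (λ a S T M → (con (ℤ.+ 1) :+ M) :* (a :* a :+ T) :=
        (a :+ S) :* (a :+ S) :+ ((M :* T :- S :* S) :+ (M :* (a :* a) :+ (T :- con (ℤ.+ 2) :* a :* S))))
      refl a (sum x′) (sum (λ i → x′ i * x′ i)) (fromℕ m))
    where
    a = x zero
    x′ : Fin m → Carrier
    x′ i = x (suc i)
    open ≡-Reasoning
    spread : 0# ≤ fromℕ m * (a * a) + (sum (λ i → x′ i * x′ i) - fromℕ 2 * a * sum x′)
    spread = subst (0# ≤_) expand (sum-nonNeg (λ i → square-nonNeg (a - x′ i)))
      where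
      expand : sum (λ i → (a - x′ i) * (a - x′ i)) ≡ fromℕ m * (a * a) +
          (sum (λ i → x′ i * x′ i) - fromℕ 2 * a * sum x′)
      expand = begin
        sum (λ i → (a - x′ i) * (a - x′ i))
          ≡⟨ sum-cong-≗ (λ i → solve 2 (λ a x → (a :- x) :* (a :- x) :=
               a :* a :+ (x :* x :+ :- (con (ℤ.+ 2) :* a) :* x)) refl a (x′ i)) ⟩
        sum (λ i → a * a + (x′ i * x′ i + - (fromℕ 2 * a) * x′ i))
          ≡⟨ trans (∑-distrib-+ (λ _ → a * a) (λ i → x′ i * x′ i + - (fromℕ 2 * a) * x′ i))
              (cong₂ _+_ (sum-constant m (a * a))
               (trans (∑-distrib-+ (λ i → x′ i * x′ i) (λ i → - (fromℕ 2 * a) * x′ i))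
                 (cong (sum (λ i → x′ i * x′ i) +_) (sum-* (- (fromℕ 2 * a)) x′)))) ⟩
        fromℕ m * (a * a) + (sum (λ i → x′ i * x′ i) + - (fromℕ 2 * a) * sum x′)
          ≡⟨ solve 4 (λ a S T M → M :* (a :* a) :+ (T :+ :- (con (ℤ.+ 2) :* a) :* S) :=
               M :* (a :* a) :+ (T :- con (ℤ.+ 2) :* a :* S)) refl a (sum x′) (sum (λ i → x′ i * x′ i))
                   (fromℕ m) ⟩
        fromℕ m * (a * a) + (sum (λ i → x′ i * x′ i) - fromℕ 2 * a * sum x′) ∎

  -- min (κ a) (κ b) is a positive semidefinite kernel, being a sum of
  -- indicators of {κ ≥ θ} × {κ ≥ θ}.
  Q-sum-≤ : ∀ {m n} (κ : Fin n → Carrier) → (∀ a → 0# ≤ κ a) → (x : Fin m → Fin n → Carrier) →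
    Q κ (λ a → sum (λ i → x i a)) ≤ fromℕ m * sum (λ i → Q κ (x i))
  Q-sum-≤ {m} {zero}  κ 0≤κ x = *-nonNeg (fromℕ-nonNeg m) (sum-nonNeg {m} (λ _ → ≤-refl))
  Q-sum-≤ {m} {suc n} κ 0≤κ x with minimiser κ
  -- The bottom layer, `κ i` times a squared total, is distributed over the `m` summands by
  -- `square-sum-≤`. The layers above it involve one index less, so the induction hypothesis applies
  -- to them.
  ... | i , κᵢ≤ = subst₂ _≤_ (sym (Q-remove-min κ (λ a → sum (λ µ → x µ a)) i κᵢ≤)) merge
      (+-mono-≤ (*-monoˡ-≤ (0≤κ i) top)
      (Q-sum-≤ (λ a → κ (punchIn i a) - κ i) (λ a → 0≤-difference (κᵢ≤ (punchIn i a))) x′))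
    where
    x′ : Fin m → Fin n → Carrier
    x′ µ a = x µ (punchIn i a)
    q : Fin m → Carrier
    q µ = Q (λ a → κ (punchIn i a) - κ i) (x′ µ)
    top : sum (λ a → sum (λ µ → x µ a)) * sum (λ a → sum (λ µ → x µ a)) ≤
          fromℕ m * sum (λ µ → sum (x µ) * sum (x µ))
    top = subst (λ s → s * s ≤ fromℕ m * sum (λ µ → sum (x µ) * sum (x µ))) (∑-comm x)
        (square-sum-≤ (λ µ → sum (x µ)))
    merge : κ i * (fromℕ m * sum (λ µ → sum (x µ) * sum (x µ))) + fromℕ m * sum q ≡ fromℕ m * sum
        (λ µ → Q κ (x µ))
    merge = begin
      κ i * (fromℕ m * sum (λ µ → sum (x µ) * sum (x µ))) + fromℕ m * sum q
        ≡⟨ solve 4 (λ k M s q → k :* (M :* s) :+ M :* q := M :* (k :* s :+ q)) refl (κ i) (fromℕ m) _ (sum q) ⟩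
      fromℕ m * (κ i * sum (λ µ → sum (x µ) * sum (x µ)) + sum q)
        ≡⟨ cong (fromℕ m *_) (trans (cong (_+ sum q) (sym (sum-* (κ i) (λ µ → sum (x µ) * sum (x µ)))))
             (sym (∑-distrib-+ (λ µ → κ i * (sum (x µ) * sum (x µ))) q))) ⟩
      fromℕ m * sum (λ µ → κ i * (sum (x µ) * sum (x µ)) + q µ)
        ≡⟨ cong (fromℕ m *_) (sum-cong-≗ (λ µ → sym (Q-remove-min κ (x µ) i κᵢ≤))) ⟩
      fromℕ m * sum (λ µ → Q κ (x µ))
        ∎
      where open ≡-Reasoning

  -- Tasks without duration are exempt.
  Disjoint : ∀ {n} (s v : Fin n → Carrier) → Set _
  Disjoint s v = ∀ a b → a ≢ b → 0# < v a → 0# < v b → s a + v a ≤ s b ⊎ s b + v b ≤ s a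

  module _ {n} (s v : Fin (suc n) → Carrier) (disjoint : Disjoint s v) (i : Fin (suc n)) where

    Disjoint-removeAt : Disjoint (λ a → s (punchIn i a)) (λ a → v (punchIn i a))
    Disjoint-removeAt a b a≢b = disjoint (punchIn i a) (punchIn i b)
        (λ eq → a≢b (Fin.punchIn-injective i a b eq))

    -- If `i` came first instead, then `s i + v i` would be at most the start of the other task,
    -- hence at most `s i`.
    before-latest : (∀ a → s a ≤ s i) → 0# < v i → ∀ a → 0# < v (punchIn i a) →
      s (punchIn i a) + v (punchIn i a) ≤ s i
    before-latest s≤sᵢ 0<vᵢ a 0<vₐ with disjoint (punchIn i a) i (Fin.punchInᵢ≢i i a) 0<vₐ 0<vᵢ
    ... | inj₁ a-first = a-first
    ... | inj₂ i-first = contradiction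
      (≤-from (≤-trans i-first (s≤sᵢ (punchIn i a)))
          (solve 2 (λ s v → con (ℤ.+ 0) :- v := s :- (s :+ v)) refl (s i) (v i)))
      (<⇒≱ 0<vᵢ)

  -- Disjoint intervals inside `[0, z]` have total length at most `z`: when the one that starts last
  -- is removed, the others fit into `[0, s i]`.
  sum-disjoint-≤ : ∀ {n} (s v : Fin n → Carrier) z → (∀ a → 0# ≤ v a) → Disjoint s v →
    (∀ a → 0# < v a → 0# ≤ s a) → (∀ a → 0# < v a → s a + v a ≤ z) → 0# ≤ z → sum v ≤ z
  sum-disjoint-≤ {zero}  s v z 0≤v disjoint 0≤s s+v≤z 0≤z = 0≤z
  sum-disjoint-≤ {suc n} s v z 0≤v disjoint 0≤s s+v≤z 0≤z with maximiser s
  ... | i , s≤sᵢ with 0# ≟ v i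
  -- Nothing is known about the start of a task without duration, so it is dropped and `z` is kept.
  ...   | yes 0≡vᵢ = subst (_≤ z) (sym (trans (sum-remove {i = i} v)
      (trans (cong (_+ sum (λ a → v (punchIn i a))) (sym 0≡vᵢ)) (+-identityˡ _))))
    (sum-disjoint-≤ _ _ z (λ a → 0≤v (punchIn i a)) (Disjoint-removeAt s v disjoint i)
      (λ a → 0≤s (punchIn i a)) (λ a → s+v≤z (punchIn i a)) 0≤z)
  ...   | no  0≢vᵢ = ≤-trans (≤-reflexive (trans (sum-remove {i = i} v) (+-comm (v i) _)))
    (≤-trans (+-mono-≤ (sum-disjoint-≤ _ _ (s i) (λ a → 0≤v (punchIn i a)) (Disjoint-removeAt s v disjoint i)
      (λ a → 0≤s (punchIn i a)) (before-latest s v disjoint i s≤sᵢ 0<vᵢ) (0≤s i 0<vᵢ)) ≤-refl) (s+v≤z i 0<vᵢ))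
    where
    0<vᵢ : 0# < v i
    0<vᵢ = 0≤v i , 0≢vᵢ

  -- The term on the right is `κ a` times twice the integral of time over the interval of `a`.
  -- Induction removes the task `i` that starts last: in its row and its column the kernel is at
  -- most `κ i` and the other durations add up to at most `s i`, so together with the diagonal they
  -- give at most the term of `i`.
  Q-disjoint-≤ : ∀ {n} (κ s v : Fin n → Carrier) → (∀ a → 0# ≤ κ a) → (∀ a → 0# ≤ v a) → Disjoint s v →
    (∀ a → 0# < v a → 0# ≤ s a) → Q κ v ≤ sum (λ a → κ a * (v a * (fromℕ 2 * s a + v a)))
  Q-disjoint-≤ {zero}  κ s v 0≤κ 0≤v disjoint 0≤s = ≤-refl
  Q-disjoint-≤ {suc n} κ s v 0≤κ 0≤v disjoint 0≤s with maximiser s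
  ... | i , s≤sᵢ = subst₂ _≤_ (sym (∑∑-remove i (λ a b → min (κ a) (κ b) * (v a * v b))))
      (trans (solve 4 (λ k v s r → k :* (v :* v) :+ k :* (v :* s) :+ (k :* (v :* s) :+ r) :=
               k :* (v :* (con (ℤ.+ 2) :* s :+ v)) :+ r) refl (κ i) (v i) (s i) _)
        (sym (sum-remove {i = i} (λ a → κ a * (v a * (fromℕ 2 * s a + v a))))))
      (+-mono-≤ (+-mono-≤ (≤-reflexive (cong (_* (v i * v i)) (min-≤ ≤-refl))) row) (+-mono-≤ column
        (Q-disjoint-≤ _ (λ a → s (punchIn i a)) (λ a → v (punchIn i a)) (λ a → 0≤κ (punchIn i a))
            (λ a → 0≤v (punchIn i a))
          (Disjoint-removeAt s v disjoint i) (λ a → 0≤s (punchIn i a)))))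
    where
    v′ : Fin n → Carrier
    v′ a = v (punchIn i a)
    earlier : v i * sum v′ ≤ v i * s i
    earlier with 0# ≟ v i
    -- Both sides are 0 here, whatever `s i` is.
    ... | yes 0≡vᵢ = ≤-reflexive (subst (λ w → w * sum v′ ≡ w * s i) 0≡vᵢ (trans (zeroˡ _) (sym (zeroˡ _))))
    ... | no  0≢vᵢ = *-monoˡ-≤ (0≤v i) (sum-disjoint-≤ (λ a → s (punchIn i a)) v′ (s i)
        (λ a → 0≤v (punchIn i a))
      (Disjoint-removeAt s v disjoint i) (λ a → 0≤s (punchIn i a))
      (before-latest s v disjoint i s≤sᵢ (0≤v i , 0≢vᵢ)) (0≤s i (0≤v i , 0≢vᵢ)))
    row : sum (λ b → min (κ i) (κ (punchIn i b)) * (v i * v′ b)) ≤ κ i * (v i * s i)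
    row = ≤-trans (sum-mono-≤ (λ b → *-monoʳ-≤ (*-nonNeg (0≤v i) (0≤v (punchIn i b)))
        (min≤ˡ (κ i) (κ (punchIn i b)))))
      (subst (_≤ κ i * (v i * s i)) (sym (trans (sum-* (κ i) (λ b → v i * v′ b))
          (cong (κ i *_) (sum-* (v i) v′))))
        (*-monoˡ-≤ (0≤κ i) earlier))
    column : sum (λ a → min (κ (punchIn i a)) (κ i) * (v′ a * v i)) ≤ κ i * (v i * s i)
    column = subst (_≤ κ i * (v i * s i))
      (sum-cong-≗ (λ a → cong₂ _*_ (min-comm (κ i) (κ (punchIn i a))) (*-comm (v i) (v′ a)))) row

-- Lower bounds on the cost of an arbitrary schedule.

lookup-injective : ∀ {a} {A : Set a} {xs : List A} → Unique xs →
  ∀ i j → lookup xs i ≡ lookup xs j → i ≡ j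
lookup-injective (x∉ ∷ xs!) zero    zero    eq = refl
lookup-injective (x∉ ∷ xs!) zero    (suc j) eq = contradiction eq (All.lookup x∉ (∈-lookup j))
lookup-injective (x∉ ∷ xs!) (suc i) zero    eq = contradiction (sym eq) (All.lookup x∉ (∈-lookup i))
lookup-injective (x∉ ∷ xs!) (suc i) (suc j) eq = cong suc (lookup-injective xs! i j eq)

module OfflineBound {c ℓ} (F : OrderedField c ℓ) where
  open OrderedField F
  open Arithmetic F
  open QuadraticForms F
  open Scheduling F
  open Job

  0<t+p : ∀ (j : Job) → 0# < t j + p j
  0<t+p j = <-≤-trans (0<t j) (x≤x+y (0≤p j))

  0<p* : ∀ (j : Job) → 0# < p* j
  0<p* j = [ (λ eq → subst (0# <_) (sym eq) (0<u j)) , (λ eq → subst (0# <_) (sym eq) (0<t+p j)) ]′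
      (min-sel (u j) (t j + p j))

  work : Bool → Job → Carrier
  work tested j = if tested then t j + p j else u j

  0<work : ∀ b j → 0# < work b j
  0<work true  j = 0<t+p j
  0<work false j = 0<u j

  p*≤work : ∀ b j → p* j ≤ work b j
  p*≤work true  j = min≤ʳ (u j) (t j + p j)
  p*≤work false j = min≤ˡ (u j) (t j + p j)

  job : ∀ {n} → Task n → Fin n
  job (test j)     = j
  job (execute j)  = j
  job (untested j) = j

  -- The form `Q` is indexed by a `Fin`, so tasks are addressed by their positions in this list. Its
  -- uniqueness turns distinct positions into distinct tasks, as `no-overlap` demands.
  allTasks : ∀ n → List (Task n)
  allTasks n = tabulate test ++ tabulate execute ++ tabulate untested

  allTasks-unique : ∀ n → Unique (allTasks n)
  allTasks-unique n = Unique.++⁺ (Unique.tabulate⁺ (λ { refl → refl }))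
    (Unique.++⁺ (Unique.tabulate⁺ (λ { refl → refl })) (Unique.tabulate⁺ (λ { refl → refl }))
      (λ (x , y) → execute≢untested (∈-tabulate⁻ x) (∈-tabulate⁻ y)))
    λ (x , y) → [ (λ z → test≢execute (∈-tabulate⁻ x) (∈-tabulate⁻ z)) ,
        (λ z → test≢untested (∈-tabulate⁻ x) (∈-tabulate⁻ z)) ]′
      (∈-++⁻ (tabulate execute) y)
    where
    execute≢untested : ∀ {a : Task n} → ∃ (λ j → a ≡ execute j) → ¬ ∃ λ j → a ≡ untested j
    execute≢untested (_ , refl) (_ , ())
    test≢execute : ∀ {a : Task n} → ∃ (λ j → a ≡ test j) → ¬ ∃ λ j → a ≡ execute j
    test≢execute (_ , refl) (_ , ())
    test≢untested : ∀ {a : Task n} → ∃ (λ j → a ≡ test j) → ¬ ∃ λ j → a ≡ untested j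
    test≢untested (_ , refl) (_ , ())

  sum-lookup-++ : ∀ {a} {A : Set a} (f : A → Carrier) xs ys →
    sum (λ i → f (lookup (xs ++ ys) i)) ≡ sum (λ i → f (lookup xs i)) + sum (λ i → f (lookup ys i))
  sum-lookup-++ f []       ys = sym (+-identityˡ _)
  sum-lookup-++ f (x ∷ xs) ys = trans (cong (f x +_) (sum-lookup-++ f xs ys)) (sym (+-assoc (f x) _ _))

  sum-lookup-tabulate : ∀ {a} {A : Set a} (f : A → Carrier) {n} (g : Fin n → A) →
    sum (λ i → f (lookup (tabulate g) i)) ≡ sum (λ j → f (g j))
  sum-lookup-tabulate f {zero}  g = refl
  sum-lookup-tabulate f {suc n} g = cong (f (g zero) +_) (sum-lookup-tabulate f (λ j → g (suc j)))

  task : ∀ {n} → Fin (length (allTasks n)) → Task n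
  task = lookup (allTasks _)

  sum-tasks : ∀ {n} (f : Task n → Carrier) →
    sum (λ a → f (task a)) ≡ sum (λ j → f (test j) + (f (execute j) + f (untested j)))
  sum-tasks {n} f = begin
    sum (λ a → f (task a))
      ≡⟨ trans (sum-lookup-++ f (tabulate test) _) (cong₂ _+_ (sum-lookup-tabulate f test)
           (trans (sum-lookup-++ f (tabulate execute) _)
               (cong₂ _+_ (sum-lookup-tabulate f execute) (sum-lookup-tabulate f untested)))) ⟩
    sum (λ j → f (test j)) + (sum (λ j → f (execute j)) + sum (λ j → f (untested j)))
      ≡⟨ cong (sum (λ j → f (test j)) +_) (sym (∑-distrib-+ (λ j → f (execute j)) (λ j → f (untested j)))) ⟩
    sum (λ j → f (test j)) + sum (λ j → f (execute j) + f (untested j))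
      ≡⟨ sym (∑-distrib-+ (λ j → f (test j)) (λ j → f (execute j) + f (untested j))) ⟩
    sum (λ j → f (test j) + (f (execute j) + f (untested j)))
      ∎
    where open ≡-Reasoning

  at : ∀ {m} → Fin m → Carrier → Fin m → Carrier
  at i x µ = if does (i Fin.≟ µ) then x else 0#

  -- Only `f 0# ≡ 0#` is asked of `f`, because it is applied both to the load of a task and to its
  -- quadratic busy-time term.
  sum-at : ∀ {m} (f : Carrier → Carrier) → f 0# ≡ 0# → ∀ i x → sum {m} (λ µ → f (at i x µ)) ≡ f x
  sum-at {m} f f0≡0 i x = trans (sum-increment {f = λ _ → 0#} i (f x) at-i elsewhere)
    (trans (cong (_+ f x) (sum-replicate-zero m)) (+-identityˡ (f x)))
    where
    at-i : f (at i x i) ≡ 0# + f x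
    at-i with i Fin.≟ i
    ... | yes _  = sym (+-identityˡ (f x))
    ... | no i≢i = contradiction refl i≢i
    elsewhere : ∀ µ → µ ≢ i → f (at i x µ) ≡ 0#
    elsewhere µ µ≢i with i Fin.≟ µ
    ... | yes i≡µ = contradiction (sym i≡µ) µ≢i
    ... | no _    = f0≡0

  module _ {m n : ℕ} {I : Instance n} (S : Schedule m I) where
    open Schedule S

    spent : Fin n → Carrier
    spent j = work (tested j) (I j)

    density : Fin n → Carrier
    density j = spent j ⁻¹

    -- Tasks that are not performed count as tasks of duration 0.
    load : Task n → Carrier
    load (test j)     = if tested j then t (I j) else 0#
    load (execute j)  = if tested j then p (I j) else 0#
    load (untested j) = if tested j then 0# else u (I j)

    load-nonNeg : ∀ a → 0# ≤ load a
    load-nonNeg (test j) with tested j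
    ... | true  = proj₁ (0<t (I j))
    ... | false = ≤-refl
    load-nonNeg (execute j) with tested j
    ... | true  = 0≤p (I j)
    ... | false = ≤-refl
    load-nonNeg (untested j) with tested j
    ... | true  = ≤-refl
    ... | false = proj₁ (0<u (I j))

    0<load⇒performed : ∀ a → 0# < load a → IsPerformed tested a × load a ≡ duration I a
    0<load⇒performed (test j) 0<l with tested j
    ... | true  = tt , refl
    ... | false = ⊥-elim (proj₂ 0<l refl)
    0<load⇒performed (execute j) 0<l with tested j
    ... | true  = tt , refl
    ... | false = ⊥-elim (proj₂ 0<l refl)
    0<load⇒performed (untested j) 0<l with tested j
    ... | true  = ⊥-elim (proj₂ 0<l refl)
    ... | false = tt , refl

    machineLoad : Fin m → Task n → Carrier
    machineLoad µ a = at (machine a) (load a) µ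

    machineLoad-nonNeg : ∀ µ a → 0# ≤ machineLoad µ a
    machineLoad-nonNeg µ a with machine a Fin.≟ µ
    ... | yes _ = load-nonNeg a
    ... | no  _ = ≤-refl

    0<machineLoad⇒ : ∀ µ a → 0# < machineLoad µ a →
      machine a ≡ µ × IsPerformed tested a × machineLoad µ a ≡ duration I a
    0<machineLoad⇒ µ a 0<l with machine a Fin.≟ µ
    ... | yes eq = eq , 0<load⇒performed a 0<l
    ... | no  _  = ⊥-elim (proj₂ 0<l refl)

    machineLoad-disjoint : ∀ µ → Disjoint (λ a → start (task a)) (λ a → machineLoad µ (task a))
    machineLoad-disjoint µ a b a≢b 0<a 0<b
      with 0<machineLoad⇒ µ (task a) 0<a | 0<machineLoad⇒ µ (task b) 0<b
    ... | onµ , pa , ≡a | onµ′ , pb , ≡b = subst₂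
      (λ x z → start (task a) + x ≤ start (task b) ⊎ start (task b) + z ≤ start (task a)) (sym ≡a) (sym ≡b)
      (no-overlap (task a) (task b) pa pb (λ eq → a≢b (lookup-injective (allTasks-unique n) a b eq))
        (trans onµ (sym onµ′)))

    κ : Fin (length (allTasks n)) → Carrier
    κ a = density (job (task a))

    density-nonNeg : ∀ j → 0# ≤ density j
    density-nonNeg j = ⁻¹-nonNeg (0<work (tested j) (I j))

    -- Twice the contribution of the task to the mean busy time of its job.
    twiceBusy : Task n → Carrier
    twiceBusy a = density (job a) * (load a * (fromℕ 2 * start a + load a))

    -- The load vector is the sum of the load vectors of the machines. `Q-sum-≤` passes to single
    -- machines at the price of the factor `m`, and `Q-disjoint-≤` treats each of them; a task then
    -- contributes on its own machine only.
    Q-load-≤ : Q κ (λ a → load (task a)) ≤ fromℕ m * sum (λ a → twiceBusy (task a))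
    Q-load-≤ = bound
      where
      g : Fin m → Fin (length (allTasks n)) → Carrier
      g µ a = κ a * (machineLoad µ (task a) * (fromℕ 2 * start (task a) + machineLoad µ (task a)))
      total : sum (λ µ → sum (g µ)) ≡ sum (λ a → twiceBusy (task a))
      total = trans (∑-comm g) (sum-cong-≗ (λ a → sum-at
        (λ x → κ a * (x * (fromℕ 2 * start (task a) + x)))
        (solve 2 (λ k s → k :* (con (ℤ.+ 0) :* (con (ℤ.+ 2) :* s :+ con (ℤ.+ 0))) := con (ℤ.+ 0)) refl (κ a)
            (start (task a)))
        (machine (task a)) (load (task a))))
      loads : ∀ a → load (task a) ≡ sum (λ µ → machineLoad µ (task a))
      loads a = sym (sum-at (λ x → x) refl (machine (task a)) (load (task a)))
      bound : Q κ (λ a → load (task a)) ≤ fromℕ m * sum (λ a → twiceBusy (task a))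
      bound = subst₂ _≤_
        (sum-cong-≗ (λ a → sum-cong-≗ (λ b → cong₂ (λ x z → min (κ a) (κ b) * (x * z)) (sym (loads a))
            (sym (loads b)))))
        (cong (fromℕ m *_) total)
        (≤-trans (Q-sum-≤ κ (λ a → density-nonNeg (job (task a))) (λ µ a → machineLoad µ (task a)))
          (*-monoˡ-≤ (fromℕ-nonNeg m) (sum-mono-≤ (λ µ → Q-disjoint-≤ κ (λ a → start (task a))
              (λ a → machineLoad µ (task a))
            (λ a → density-nonNeg (job (task a))) (λ a → machineLoad-nonNeg µ (task a)) (machineLoad-disjoint µ)
            (λ a 0<l → start≥0 (task a) (proj₁ (proj₂ (0<machineLoad⇒ µ (task a) 0<l))))))))

    loads≡spent : ∀ j → load (test j) + (load (execute j) + load (untested j)) ≡ spent j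
    loads≡spent j with tested j
    ... | true  = cong (t (I j) +_) (+-identityʳ _)
    ... | false = trans (+-identityˡ _) (+-identityˡ _)

    sum-load : ∀ (g : Fin n → Carrier) → sum (λ a → g (job (task a)) * load (task a)) ≡ sum
        (λ j → g j * spent j)
    sum-load g = trans (sum-tasks (λ a → g (job a) * load a)) (sum-cong-≗ (λ j →
      trans (solve 4 (λ g x y z → g :* x :+ (g :* y :+ g :* z) := g :* (x :+ (y :+ z))) refl
        (g j) (load (test j)) (load (execute j)) (load (untested j)))
        (cong (g j *_) (loads≡spent j))))

    -- All tasks of a job have the same density, so their loads merge into `spent`, first in the one
    -- argument and then in the other.
    Q-load≡ : Q κ (λ a → load (task a)) ≡ sum (λ j → sum
        (λ k → min (density j) (density k) * (spent j * spent k)))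
    Q-load≡ = begin
      sum (λ a → sum (λ b → min (κ a) (κ b) * (load (task a) * load (task b))))
        ≡⟨ sum-cong-≗ (λ a → trans (sum-cong-≗ (λ b → rearrange (min (κ a) (κ b)) (load (task a))
            (load (task b))))
             (sum-* (load (task a)) (λ b → min (κ a) (κ b) * load (task b)))) ⟩
      sum (λ a → load (task a) * sum (λ b → min (κ a) (κ b) * load (task b)))
        ≡⟨ sum-cong-≗ (λ a → trans (cong (load (task a) *_) (sum-load (λ k → min (κ a) (density k))))
            (*-comm (load (task a)) _)) ⟩
      sum (λ a → row (job (task a)) * load (task a))
        ≡⟨ sum-load row ⟩
      sum (λ j → row j * spent j)
        ≡⟨ sum-cong-≗ (λ j → trans (*-comm (row j) (spent j)) (sym (trans
             (sum-cong-≗ (λ k → rearrange (min (density j) (density k)) (spent j) (spent k)))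
             (sum-* (spent j) (λ k → min (density j) (density k) * spent k))))) ⟩
      sum (λ j → sum (λ k → min (density j) (density k) * (spent j * spent k)))
        ∎
      where
      open ≡-Reasoning
      row : Fin n → Carrier
      row j = sum (λ k → min (density j) (density k) * spent k)
      rearrange : ∀ x y z → x * (y * z) ≡ y * (x * z)
      rearrange = solve 3 (λ x y z → x :* (y :* z) := y :* (x :* z)) refl

    spent*density : ∀ j → spent j * density j ≡ 1#
    spent*density j = *-inverse (0<work (tested j) (I j))

    -- Densities being reciprocals, the right-hand side is the smaller of `spent j` and `spent k`:
    -- the density that attains the minimum cancels the work on its own job.
    min-p*-≤ : ∀ j k → min (p* (I j)) (p* (I k)) ≤ min (density j) (density k) * (spent j * spent k)
    min-p*-≤ j k = [ (λ eq → subst (λ d → _ ≤ d * (spent j * spent k)) (sym eq)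
                       (≤-trans (min≤ʳ (p* (I j)) (p* (I k)))
                           (≤-trans (p*≤work (tested k) (I k)) (≤-reflexive (yk)))))
                   , (λ eq → subst (λ d → _ ≤ d * (spent j * spent k)) (sym eq)
                       (≤-trans (min≤ˡ (p* (I j)) (p* (I k)))
                           (≤-trans (p*≤work (tested j) (I j)) (≤-reflexive (yj))))) ]′
                   (min-sel (density j) (density k))
      where
      yk : spent k ≡ density j * (spent j * spent k)
      yk = trans (trans (sym (*-identityˡ (spent k))) (cong (_* spent k) (sym (spent*density j))))
        (solve 3 (λ d a b → a :* d :* b := d :* (a :* b)) refl (density j) (spent j) (spent k))
      yj : spent j ≡ density k * (spent j * spent k)
      yj = trans (trans (sym (*-identityʳ (spent j))) (cong (spent j *_) (sym (spent*density k))))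
        (solve 3 (λ d a b → a :* (b :* d) := d :* (a :* b)) refl (density k) (spent j) (spent k))

    -- For a tested job the slack is `2 t` times the pause between test and execution; an untested
    -- job has equality.
    work-busy-≤ : ∀ j → load (test j) * (fromℕ 2 * start (test j) + load (test j)) +
      (load (execute j) * (fromℕ 2 * start (execute j) + load (execute j)) +
       load (untested j) * (fromℕ 2 * start (untested j) + load (untested j))) ≤
      spent j * (fromℕ 2 * completion j - spent j)
    work-busy-≤ j with tested j | test-first j
    ... | true  | first = ≤-by (fromℕ 2 * t (I j) * (start (execute j) - (start (test j) + t (I j))))
      (*-nonNeg (*-nonNeg (fromℕ-nonNeg 2) (proj₁ (0<t (I j)))) (0≤-difference (first tt)))
      (solve 5 (λ t p s e z → (t :+ p) :* (con (ℤ.+ 2) :* (e :+ p) :- (t :+ p)) :=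
          t :* (con (ℤ.+ 2) :* s :+ t) :+ (p :* (con (ℤ.+ 2) :* e :+ p) :+ con (ℤ.+ 0) :*
              (con (ℤ.+ 2) :* z :+ con (ℤ.+ 0)))
          :+ con (ℤ.+ 2) :* t :* (e :- (s :+ t))) refl
        (t (I j)) (p (I j)) (start (test j)) (start (execute j)) (start (untested j)))
    ... | false | _     = ≤-reflexive
      (solve 4 (λ u s e z → con (ℤ.+ 0) :* (con (ℤ.+ 2) :* s :+ con (ℤ.+ 0)) :+
          (con (ℤ.+ 0) :* (con (ℤ.+ 2) :* e :+ con (ℤ.+ 0))
          :+ u :* (con (ℤ.+ 2) :* z :+ u)) := u :* (con (ℤ.+ 2) :* (z :+ u) :- u)) refl
        (u (I j)) (start (test j)) (start (execute j)) (start (untested j)))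

    busy-≤ : ∀ j → twiceBusy (test j) + (twiceBusy (execute j) + twiceBusy (untested j)) ≤ fromℕ 2 *
        completion j - spent j
    busy-≤ j = subst₂ _≤_
      (solve 4 (λ d a b c → d :* (a :+ (b :+ c)) := d :* a :+ (d :* b :+ d :* c)) refl (density j) _ _ _)
      (trans (solve 3 (λ d y z → d :* (y :* z) := (y :* d) :* z) refl (density j) (spent j)
          (fromℕ 2 * completion j - spent j))
        (trans (cong (_* (fromℕ 2 * completion j - spent j)) (spent*density j)) (*-identityˡ _)))
      (*-monoˡ-≤ (density-nonNeg j) (work-busy-≤ j))

    -- The bound of Eastman, Even and Isaacs, by way of mean busy times.
    min-p*-cost : sum (λ j → sum (λ k → min (p* (I j)) (p* (I k)))) + fromℕ m * sum (λ j → p* (I j)) ≤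
                  fromℕ 2 * fromℕ m * cost
    min-p*-cost = ≤-trans (+-mono-≤ pairs ≤-refl) (≤-trans (≤-reflexive (sym (trans
        (cong (fromℕ m *_) (∑-distrib-+ (λ j → fromℕ 2 * completion j - spent j) (λ j → p* (I j))))
        (solve 3 (λ m a b → m :* (a :+ b) := m :* a :+ m :* b) refl (fromℕ m) _ _))))
      (subst (fromℕ m * sum (λ j → fromℕ 2 * completion j - spent j + p* (I j)) ≤_)
        (trans (cong (fromℕ m *_) (sum-* (fromℕ 2) completion))
          (solve 2 (λ m c → m :* (con (ℤ.+ 2) :* c) := con (ℤ.+ 2) :* m :* c) refl (fromℕ m) cost))
        -- The subtracted `spent j` absorbs the added `p* (I j)`.
        (*-monoˡ-≤ (fromℕ-nonNeg m) (sum-mono-≤ (λ j → ≤-from (p*≤work (tested j) (I j))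
          (solve 3 (λ c y q → c :- (c :- y :+ q) := y :- q) refl (fromℕ 2 * completion j) (spent j)
              (p* (I j))))))))
      where
      pairs : sum (λ j → sum (λ k → min (p* (I j)) (p* (I k)))) ≤ fromℕ m * sum
          (λ j → fromℕ 2 * completion j - spent j)
      pairs = ≤-trans (sum-mono-≤ (λ j → sum-mono-≤ (λ k → min-p*-≤ j k)))
        (subst (_≤ fromℕ m * sum (λ j → fromℕ 2 * completion j - spent j)) Q-load≡ (≤-trans Q-load-≤
          (*-monoˡ-≤ (fromℕ-nonNeg m) (subst (_≤ sum (λ j → fromℕ 2 * completion j - spent j))
              (sym (sum-tasks twiceBusy))
            (sum-mono-≤ busy-≤)))))

    work≤completion : ∀ j → spent j ≤ completion j
    work≤completion j with tested j | test-first j | start≥0 (test j) | start≥0 (untested j)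
    ... | true  | first | 0≤s | _ = ≤-trans
      (≤-by (start (test j)) (0≤s tt) (solve 3 (λ s t p → s :+ t :+ p := t :+ p :+ s) refl (start (test j))
          (t (I j)) (p (I j))))
      (+-mono-≤ (first tt) ≤-refl)
    ... | false | _ | _ | 0≤s = ≤-by (start (untested j)) (0≤s tt) (+-comm (start (untested j)) (u (I j)))

    p*-cost : sum (λ j → p* (I j)) ≤ cost
    p*-cost = sum-mono-≤ (λ j → ≤-trans (p*≤work (tested j) (I j)) (work≤completion j))

-- The numerator of `R-ratio`, split by the outcome of the coin.

module PairBound {c ℓ} (F : OrderedField c ℓ) (β : OrderedField.Carrier F)
  (0<β : OrderedField._<_ F (OrderedField.0# F) β) where

  open OrderedField F
  open Arithmetic F
  open Scheduling F
  open OfflineBound F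
  open Job

  1/β : Carrier
  1/β = 1# / β

  1/β*β : ∀ x → 1/β * (β * x) ≡ x
  1/β*β x = trans (solve 3 (λ i b x → con (ℤ.+ 1) :* i :* (b :* x) := (b :* i) :* x) refl (β ⁻¹) β x)
    (trans (cong (_* x) (*-inverse 0<β)) (*-identityˡ x))

  1/β-nonNeg : 0# ≤ 1/β
  1/β-nonNeg = *-nonNeg 0≤1 (⁻¹-nonNeg 0<β)

  -- The mean of this quantity over the coin of `k`, which is `true` with probability `ℙ P k`, is
  -- the numerator of `R-ratio` at `k`.
  pairBound : Bool → Job → Carrier
  pairBound true  k = max (max (fromℕ 2 * t k + p k) (β * t k)) ((1# + 1/β) * (t k + p k))
  pairBound false k = (1# + 1/β) * u k

  work≤pairBound : ∀ b k → work b k ≤ pairBound b k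
  work≤pairBound true k = ≤-trans (≤-by (t k) (proj₁ (0<t k))
      (solve 2 (λ t p → con (ℤ.+ 2) :* t :+ p := t :+ p :+ t) refl (t k) (p k)))
    (≤-trans (max≥ˡ _ (β * t k)) (max≥ˡ _ ((1# + 1/β) * (t k + p k))))
  work≤pairBound false k = ≤-by (1/β * u k) (*-nonNeg 1/β-nonNeg (proj₁ (0<u k)))
    (solve 2 (λ i u → (con (ℤ.+ 1) :+ i) :* u := u :+ i :* u) refl 1/β (u k))

-- A tested job is prompt if every queued task weighs more than its execution,
-- which then starts as soon as its test ends; it is testing as long as no such
-- heavier task has been started since its test was.
data Phase : Set where
  waiting testing prompt started : Phase

-- `Counting` singles out the phases in which newly started work is charged to the job as delay. A
-- job in test is still among them unless it is prompt, since its execution may have to queue.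
Counting InTest : Phase → Set
Counting waiting = ⊤
Counting testing = ⊤
Counting _       = ⊥
InTest testing = ⊤
InTest prompt  = ⊤
InTest _       = ⊥

-- Accounting for the delays that two jobs cause each other.

module Delays {c ℓ} (F : OrderedField c ℓ) (m : ℕ) (β : OrderedField.Carrier F)
  (0<β : OrderedField._<_ F (OrderedField.0# F) β)
  {n : ℕ} (I : Scheduling.Instance F n) (coins : Vec Bool n) where

  open OrderedField F
  open Arithmetic F
  open Scheduling F
  open OfflineBound F
  open PairBound F β 0<β
  open Job
  open RPCPM m β I

  coin : Fin n → Bool
  coin = Vec.lookup coins

  total : Fin n → Carrier
  total k = work (coin k) (I k)

  progress : Phase → Fin n → Carrier
  progress waiting k = 0#
  progress testing k = t (I k)
  progress prompt  k = t (I k)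
  progress started k = total k

  -- While k is counting, only tasks of at most this weight are started.
  limit : Phase → Fin n → Carrier
  limit waiting k = weight (initialTask coins k)
  limit _       k = t (I k) + p (I k)

  charge : Phase → Carrier → Carrier
  charge waiting d = d
  charge testing d = d
  charge prompt  d = 0#
  charge started d = 0#

  charge≤ : ∀ ph {d} → 0# ≤ d → charge ph d ≤ d
  charge≤ waiting 0≤d = ≤-refl
  charge≤ testing 0≤d = ≤-refl
  charge≤ prompt  0≤d = 0≤d
  charge≤ started 0≤d = 0≤d

  charge-nonNeg : ∀ ph {d} → 0# ≤ d → 0# ≤ charge ph d
  charge-nonNeg waiting 0≤d = 0≤d
  charge-nonNeg testing 0≤d = 0≤d
  charge-nonNeg prompt  0≤d = ≤-refl
  charge-nonNeg started 0≤d = ≤-refl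

  charge-counting : ∀ ph d → Counting ph → charge ph d ≡ d
  charge-counting waiting d _ = refl
  charge-counting testing d _ = refl

  duration-nonNeg : ∀ a → 0# ≤ duration I a
  duration-nonNeg (test j)     = proj₁ (0<t (I j))
  duration-nonNeg (execute j)  = 0≤p (I j)
  duration-nonNeg (untested j) = proj₁ (0<u (I j))

  progress-nonNeg : ∀ ph k → 0# ≤ progress ph k
  progress-nonNeg waiting k = ≤-refl
  progress-nonNeg testing k = proj₁ (0<t (I k))
  progress-nonNeg prompt  k = proj₁ (0<t (I k))
  progress-nonNeg started k = proj₁ (0<work (coin k) (I k))

  progress≤total : ∀ ph k → (InTest ph → coin k ≡ true) → progress ph k ≤ total k
  progress≤total waiting k tested = proj₁ (0<work (coin k) (I k))
  progress≤total testing k tested rewrite tested tt = x≤x+y (0≤p (I k))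
  progress≤total prompt  k tested rewrite tested tt = x≤x+y (0≤p (I k))
  progress≤total started k tested = ≤-refl

  -- For a delay of `k` by a test: a test of weight at most `limit` lasts at most `limit / β`, and
  -- all the work on `k` may still delay the tested job. A waiting job gives `2 t + p` if tested and
  -- `(1 + 1/β) u` if not; a testing one gives `(1 + 1/β) (t + p)`.
  limit/β : ∀ ph k → (InTest ph → coin k ≡ true) → Counting ph →
    1/β * limit ph k + total k ≤ pairBound (coin k) (I k)
  limit/β waiting k _ _ with coin k
  ... | true  = subst (_≤ pairBound true (I k)) (cong (_+ (t (I k) + p (I k))) (sym (1/β*β (t (I k)))))
    (≤-trans (≤-reflexive (solve 2 (λ t p → t :+ (t :+ p) := con (ℤ.+ 2) :* t :+ p) refl (t (I k)) (p (I k))))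
      (≤-trans (max≥ˡ _ (β * t (I k))) (max≥ˡ _ _)))
  ... | false = ≤-reflexive (solve 2 (λ i u → i :* u :+ u := (con (ℤ.+ 1) :+ i) :* u) refl 1/β (u (I k)))
  limit/β testing k tested _ rewrite tested tt = ≤-trans
    (≤-reflexive (solve 2 (λ i u → i :* u :+ u := (con (ℤ.+ 1) :+ i) :* u) refl 1/β (t (I k) + p (I k))))
    (max≥ʳ _ _)

  -- For a delay of `k` by a job whose last task is being started: the work on that job is at most
  -- `limit`, and `k` has delayed it by no more than the progress of `k` so far. If `k` is tested,
  -- this gives `β t` while it is waiting and `2 t + p` while it is testing.
  limit+progress : ∀ ph k → (InTest ph → coin k ≡ true) → Counting ph →
    limit ph k + progress ph k ≤ pairBound (coin k) (I k)
  limit+progress waiting k _ _ with coin k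
  ... | true  = ≤-trans (≤-reflexive (+-identityʳ _)) (≤-trans (max≥ʳ _ _) (max≥ˡ _ _))
  ... | false = ≤-trans (≤-reflexive (+-identityʳ _)) (work≤pairBound false (I k))
  limit+progress testing k tested _ rewrite tested tt = ≤-trans
    (≤-reflexive (solve 2 (λ t p → t :+ p :+ t := con (ℤ.+ 2) :* t :+ p) refl (t (I k)) (p (I k))))
    (≤-trans (max≥ˡ _ (β * t (I k))) (max≥ˡ _ _))

  next : Task n → Phase
  next (test _)     = testing
  next (execute _)  = started
  next (untested _) = started

  data Startable : Task n → Phase → Set where
    test     : ∀ {j} → coin j ≡ true → Startable (test j) waiting
    untested : ∀ {j} → coin j ≡ false → Startable (untested j) waiting
    execute  : ∀ {j ph} → InTest ph → coin j ≡ true → Startable (execute j) ph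

  -- How starting a task of weight x changes the phase of another job k.
  data Updated (x : Carrier) (k : Fin n) : Phase → Phase → Set (c ⊔ ℓ) where
    waiting : x ≤ weight (initialTask coins k) → Updated x k waiting waiting
    testing : x ≤ t (I k) + p (I k) → Updated x k testing testing
    demoted : t (I k) + p (I k) < x → Updated x k testing prompt
    prompt  : Updated x k prompt prompt
    started : Updated x k started started

  module _ {x : Carrier} {k : Fin n} where
    Updated-progress : ∀ {ph ph′} → Updated x k ph ph′ → progress ph′ k ≡ progress ph k
    Updated-progress (waiting _) = refl
    Updated-progress (testing _) = refl
    Updated-progress (demoted _) = refl
    Updated-progress prompt      = refl
    Updated-progress started     = refl

    Updated-inTest : ∀ {ph ph′} → Updated x k ph ph′ → InTest ph′ → InTest ph
    Updated-inTest (testing _) _ = tt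
    Updated-inTest (demoted _) _ = tt
    Updated-inTest prompt      _ = tt

    Updated-inTest′ : ∀ {ph ph′} → Updated x k ph ph′ → InTest ph → InTest ph′
    Updated-inTest′ (testing _) _ = tt
    Updated-inTest′ (demoted _) _ = tt
    Updated-inTest′ prompt      _ = tt

    Updated-counting : ∀ {ph ph′} → Updated x k ph ph′ → Counting ph′ → Counting ph
    Updated-counting (waiting _) _ = tt
    Updated-counting (testing _) _ = tt

    Updated-limit : ∀ {ph ph′} → Updated x k ph ph′ → Counting ph′ → x ≤ limit ph k
    Updated-limit (waiting x≤) _ = x≤
    Updated-limit (testing x≤) _ = x≤

    Updated-started : ∀ {ph ph′} → Updated x k ph ph′ → ph ≡ started → ph′ ≡ started
    Updated-started started _ = refl

    Updated-waiting : ∀ {ph ph′} → Updated x k ph ph′ → ph ≡ waiting → ph′ ≡ waiting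
    Updated-waiting (waiting _) _ = refl

    Updated-waiting′ : ∀ {ph ph′} → Updated x k ph ph′ → ph′ ≡ waiting → ph ≡ waiting
    Updated-waiting′ (waiting _) _ = refl

  update : Carrier → Fin n → Phase → Phase
  update x k testing = if does (x ≤? t (I k) + p (I k)) then testing else prompt
  update x k ph      = ph

  updated : ∀ x k ph → (ph ≡ waiting → x ≤ weight (initialTask coins k)) → Updated x k ph (update x k ph)
  updated x k waiting x≤ = waiting (x≤ refl)
  updated x k testing x≤ with x ≤? t (I k) + p (I k)
  ... | yes x≤w = testing x≤w
  ... | no  x≰w = demoted (≰⇒> x≰w)
  updated x k prompt  x≤ = prompt
  updated x k started x≤ = started

  startable-progress : ∀ {a ph} → Startable a ph → progress (next a) (job a) ≡ progress ph
      (job a) + duration I a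
  startable-progress (test _) = sym (+-identityˡ _)
  startable-progress (untested eq) rewrite eq = sym (+-identityˡ _)
  startable-progress {execute j} {testing} (execute _ eq) rewrite eq = refl
  startable-progress {execute j} {prompt}  (execute _ eq) rewrite eq = refl

  startable⇒¬started : ∀ {a ph} → Startable a ph → ph ≢ started
  startable⇒¬started (execute () _) refl

  -- delay j k is the work on j that may delay k: the work on j started while k
  -- is counting.
  record Accounts (phase : Fin n → Phase) (delay : Fin n → Fin n → Carrier) : Set (c ⊔ ℓ) where
    field
      tested     : ∀ k → InTest (phase k) → coin k ≡ true
      delay-self : ∀ k → delay k k ≡ 0#
      counted    : ∀ j k → j ≢ k → Counting (phase k) → delay j k ≡ progress (phase j) j
      delay≤     : ∀ j k → j ≢ k → delay j k ≤ progress (phase j) j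
      -- The left alternative leaves room for everything that `k` may yet add to the delay of `j`.
      -- It is given up only when the last task of `j` is started while `k` is counting; from then
      -- on both delays are final, because neither job's delay of the other grows once `j` is
      -- started.
      paired     : ∀ j k → j ≢ k → delay j k + total k ≤ pairBound (coin k) (I k) ⊎
                   phase j ≡ started × delay j k + delay k j ≤ pairBound (coin k) (I k)

    pair-≤ : ∀ j k → j ≢ k → delay j k + delay k j ≤ pairBound (coin k) (I k)
    pair-≤ j k j≢k with paired j k j≢k
    ... | inj₁ first = ≤-trans (+-monoʳ-≤ (delay j k)
        (≤-trans (delay≤ k j (λ eq → j≢k (sym eq))) (progress≤total (phase k) k (tested k)))) first
    ... | inj₂ (_ , both) = both

  accounts-initial : Accounts (λ _ → waiting) (λ _ _ → 0#)
  accounts-initial = record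
    { tested     = λ _ ()
    ; delay-self = λ _ → refl
    ; counted    = λ _ _ _ _ → refl
    ; delay≤     = λ _ _ _ → ≤-refl
    ; paired     = λ j k _ → inj₁ (≤-trans (≤-reflexive (+-identityˡ _)) (work≤pairBound (coin k) (I k)))
    }

  module StartTask (a : Task n) {phase : Fin n → Phase} {delay : Fin n → Fin n → Carrier}
    (accounts : Accounts phase delay) (startable : Startable a (phase (job a)))
    (light : ∀ k → k ≢ job a → phase k ≡ waiting → weight a ≤ weight (initialTask coins k)) where

    open Accounts accounts

    i : Fin n
    i = job a

    phase′ : Fin n → Phase
    phase′ k = if does (k Fin.≟ i) then next a else update (weight a) k (phase k)

    phase′-self : phase′ i ≡ next a
    phase′-self with i Fin.≟ i
    ... | yes _  = refl
    ... | no i≢i = contradiction refl i≢i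

    phase′-other : ∀ k → k ≢ i → Updated (weight a) k (phase k) (phase′ k)
    phase′-other k k≢i with k Fin.≟ i
    ... | yes k≡i = contradiction k≡i k≢i
    ... | no _    = updated (weight a) k (phase k) (light k k≢i)

    -- The charge is determined by the phase of `k` after the start, so a task that demotes `k` to
    -- `prompt` is not itself charged to `k`.
    delay′ : Fin n → Fin n → Carrier
    delay′ j k = delay j k +
      (if does (j Fin.≟ i) then (if does (k Fin.≟ i) then 0# else charge (phase′ k) (duration I a)) else 0#)

    delay′-other : ∀ j k → j ≢ i → delay′ j k ≡ delay j k
    delay′-other j k j≢i with j Fin.≟ i
    ... | yes j≡i = contradiction j≡i j≢i
    ... | no _    = +-identityʳ _

    delay′-row : ∀ k → k ≢ i → delay′ i k ≡ delay i k + charge (phase′ k) (duration I a)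
    delay′-row k k≢i with i Fin.≟ i
    ... | no i≢i = contradiction refl i≢i
    ... | yes _ with k Fin.≟ i
    ...   | yes k≡i = contradiction k≡i k≢i
    ...   | no _    = refl

    delay≤delay′ : ∀ j k → delay j k ≤ delay′ j k
    delay≤delay′ j k with j Fin.≟ i
    ... | no _ = ≤-reflexive (sym (+-identityʳ _))
    ... | yes _ with k Fin.≟ i
    ...   | yes _ = ≤-reflexive (sym (+-identityʳ _))
    ...   | no _  = x≤x+y (charge-nonNeg (update (weight a) k (phase k)) (duration-nonNeg a))

    progress′-self : progress (phase′ i) i ≡ progress (phase i) i + duration I a
    progress′-self = trans (cong (λ ph → progress ph i) phase′-self) (startable-progress startable)

    progress′-other : ∀ k → k ≢ i → progress (phase′ k) k ≡ progress (phase k) k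
    progress′-other k k≢i = Updated-progress (phase′-other k k≢i)

    counting-before : ∀ k → Counting (phase′ k) → Counting (phase k)
    counting-before k counting with k Fin.≟ i
    ... | yes refl = go startable counting
      where
      go : ∀ {b ph} → Startable b ph → Counting (next b) → Counting ph
      go (test _) _ = tt
    ... | no k≢i = Updated-counting (updated (weight a) k (phase k) (light k k≢i)) counting

    -- If `k` is not counting, nothing is charged. Otherwise `counted` identifies the delay with all
    -- the work on `i`, which the weight of the new task controls: a test preserves the left
    -- alternative by `limit/β`, a last task moves to the right one by `limit+progress`.
    paired-row : ∀ k → k ≢ i → delay i k + total k ≤ pairBound (coin k) (I k) ⊎
        phase i ≡ started × delay i k + delay k i ≤ pairBound (coin k) (I k) →
      delay i k + charge (phase′ k) (duration I a) + total k ≤ pairBound (coin k) (I k) ⊎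
        phase′ i ≡ started × delay i k + charge (phase′ k) (duration I a) + delay k i ≤ pairBound (coin k) (I k)
    paired-row k k≢i (inj₂ (i-started , _)) = contradiction i-started (startable⇒¬started startable)
    paired-row k k≢i (inj₁ first) = go (phase′ k) refl
      where
      B = pairBound (coin k) (I k)
      d = duration I a
      frozen : ∀ x → x + 0# + total k ≡ x + total k
      frozen x = cong (_+ total k) (+-identityʳ x)
      -- The weight of an execution includes the length of its test, so for a last task the weight
      -- equals the whole work on its job.
      weigh : ∀ {b ph} → Startable b ph → (next b ≡ started × progress ph (job b) + duration I b ≡ weight b) ⊎
                         progress ph (job b) + duration I b ≡ 1/β * weight b
      weigh {test j} (test _) = inj₂ (trans (+-identityˡ _) (sym (1/β*β (t (I j)))))
      weigh (untested _)      = inj₁ (refl , +-identityˡ _)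
      weigh {ph = testing} (execute _ _) = inj₁ (refl , refl)
      weigh {ph = prompt}  (execute _ _) = inj₁ (refl , refl)
      count : Counting (phase′ k) →
        delay i k + d + total k ≤ B ⊎ phase′ i ≡ started × delay i k + d + delay k i ≤ B
      count counting rewrite counted i k (λ eq → k≢i (sym eq)) (Updated-counting (phase′-other k k≢i) counting)
        with weigh startable
      ... | inj₁ (is-started , eq) = inj₂ (trans phase′-self is-started ,
        ≤-trans (+-mono-≤ (≤-trans (≤-reflexive eq) (Updated-limit (phase′-other k k≢i) counting))
            (delay≤ k i k≢i))
          (limit+progress (phase k) k (tested k) (Updated-counting (phase′-other k k≢i) counting)))
      ... | inj₂ eq = inj₁ (≤-trans (+-mono-≤ (≤-trans (≤-reflexive eq)
          (*-monoˡ-≤ 1/β-nonNeg (Updated-limit (phase′-other k k≢i) counting))) ≤-refl)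
          (limit/β (phase k) k (tested k) (Updated-counting (phase′-other k k≢i) counting)))
      go : ∀ ph → phase′ k ≡ ph →
        delay i k + charge ph d + total k ≤ B ⊎ phase′ i ≡ started × delay i k + charge ph d + delay k i ≤ B
      go waiting eq = count (subst Counting (sym eq) tt)
      go testing eq = count (subst Counting (sym eq) tt)
      go prompt  eq = inj₁ (subst (_≤ B) (sym (frozen (delay i k))) first)
      go started eq = inj₁ (subst (_≤ B) (sym (frozen (delay i k))) first)

    accounts′ : Accounts phase′ delay′
    accounts′ = record
      { tested     = tested′
      ; delay-self = λ k → self′ k
      ; counted    = counted′
      ; delay≤     = delay≤′
      ; paired     = paired′
      }
      where
      tested′ : ∀ k → InTest (phase′ k) → coin k ≡ true
      tested′ k inTest with k Fin.≟ i
      ... | no k≢i = tested k (Updated-inTest (updated (weight a) k (phase k) (light k k≢i)) inTest)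
      ... | yes refl = go startable inTest
        where
        go : ∀ {b ph} → Startable b ph → InTest (next b) → coin (job b) ≡ true
        go (test eq) _ = eq

      self′ : ∀ k → delay′ k k ≡ 0#
      self′ k with k Fin.≟ i
      ... | yes _ = trans (+-identityʳ _) (delay-self k)
      ... | no _  = trans (+-identityʳ _) (delay-self k)

      counted′ : ∀ j k → j ≢ k → Counting (phase′ k) → delay′ j k ≡ progress (phase′ j) j
      counted′ j k j≢k counting = by-cases (j Fin.≟ i) (k Fin.≟ i)
        where
        before : delay j k ≡ progress (phase j) j
        before = counted j k j≢k (counting-before k counting)
        by-cases : Dec (j ≡ i) → Dec (k ≡ i) → delay′ j k ≡ progress (phase′ j) j
        by-cases (no j≢i)   _          = trans (delay′-other j k j≢i)
            (trans before (sym (progress′-other j j≢i)))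
        by-cases (yes refl) (yes refl) = contradiction refl j≢k
        by-cases (yes refl) (no k≢i)   = trans (delay′-row k k≢i)
          (trans (cong₂ _+_ before (charge-counting (phase′ k) (duration I a) counting)) (sym progress′-self))

      delay≤′ : ∀ j k → j ≢ k → delay′ j k ≤ progress (phase′ j) j
      delay≤′ j k j≢k = by-cases (j Fin.≟ i) (k Fin.≟ i)
        where
        by-cases : Dec (j ≡ i) → Dec (k ≡ i) → delay′ j k ≤ progress (phase′ j) j
        by-cases (no j≢i)   _          = subst₂ _≤_ (sym (delay′-other j k j≢i))
            (sym (progress′-other j j≢i)) (delay≤ j k j≢k)
        by-cases (yes refl) (yes refl) = contradiction refl j≢k
        by-cases (yes refl) (no k≢i)   = subst₂ _≤_ (sym (delay′-row k k≢i)) (sym progress′-self)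
          (+-mono-≤ (delay≤ i k j≢k) (charge≤ (phase′ k) (duration-nonNeg a)))

      paired′ : ∀ j k → j ≢ k → delay′ j k + total k ≤ pairBound (coin k) (I k) ⊎
        phase′ j ≡ started × delay′ j k + delay′ k j ≤ pairBound (coin k) (I k)
      paired′ j k j≢k = by-cases (j Fin.≟ i) (k Fin.≟ i)
        where
        Paired : Carrier → Carrier → Set _
        Paired x z = x + total k ≤ pairBound (coin k) (I k) ⊎ phase′ j ≡ started × x + z ≤ pairBound
            (coin k) (I k)
        by-cases : Dec (j ≡ i) → Dec (k ≡ i) → Paired (delay′ j k) (delay′ k j)
        by-cases (yes refl) (yes refl) = contradiction refl j≢k
        by-cases (yes refl) (no k≢i)   = subst₂ Paired (sym (delay′-row k k≢i)) (sym (delay′-other k i k≢i))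
          (paired-row k k≢i (paired i k j≢k))
        by-cases (no j≢i) (no k≢i) = subst₂ Paired (sym (delay′-other j k j≢i)) (sym (delay′-other k j k≢i))
          (still (paired j k j≢k))
          where
          still : _ → Paired (delay j k) (delay k j)
          still (inj₁ first) = inj₁ first
          still (inj₂ (j-started , both)) = inj₂ (Updated-started (phase′-other j j≢i) j-started , both)
        -- Here the reverse delay `delay i j` may grow. The left alternative does not mention it,
        -- and in the right one `j` is started, so nothing is charged.
        by-cases (no j≢i) (yes refl) = subst (λ x → Paired x (delay′ i j)) (sym (delay′-other j i j≢i))
            (still (paired j i j≢k))
          where
          still : _ → Paired (delay j i) (delay′ i j)
          still (inj₁ first) = inj₁ first
          still (inj₂ (j-started , both)) = inj₂ (j-started′ , subst
              (λ x → delay j i + x ≤ pairBound (coin i) (I i))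
              (sym (trans (delay′-row j j≢i) (trans
                  (cong (λ ph → delay i j + charge ph (duration I a)) j-started′) (+-identityʳ _)))) both)
            where
            j-started′ : phase′ j ≡ started
            j-started′ = Updated-started (phase′-other j j≢i) j-started

-- The invariant of a run and the cost for fixed coins.

Unique-resp-↭ : ∀ {a} {A : Set a} {xs ys : List A} → xs ↭ ys → Unique xs → Unique ys
Unique-resp-↭ {A = A} xs↭ys = PermSetoid.Unique-resp-↭ (setoid A) (↭⇒↭ₛ xs↭ys)

module Run {c ℓ} (F : OrderedField c ℓ) (m : ℕ) .{{m≢0 : NonZero m}} (β : OrderedField.Carrier F)
  (0<β : OrderedField._<_ F (OrderedField.0# F) β)
  {n : ℕ} (I : Scheduling.Instance F n) (coins : Vec Bool n) where

  open OrderedField F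
  open Arithmetic F
  open QuadraticForms F using (sum-*)
  open Scheduling F
  open OfflineBound F
  open PairBound F β 0<β
  open Job
  open RPCPM m β I
  open Delays F m β 0<β I coins

  ∑ : ∀ {a} {A : Set a} → List A → (A → Carrier) → Carrier
  ∑ xs f = sum (λ i → f (lookup xs i))

  ∑-↭ : ∀ {a} {A : Set a} {xs ys : List A} (f : A → Carrier) → xs ↭ ys → ∑ xs f ≡ ∑ ys f
  ∑-↭ f Perm.refl          = refl
  ∑-↭ f (Perm.prep x ρ)    = cong (f x +_) (∑-↭ f ρ)
  ∑-↭ {xs = x ∷ y ∷ xs} f (Perm.swap x y ρ)  = trans (cong (λ s → f x + (f y + s)) (∑-↭ f ρ))
    (solve 3 (λ x y s → x :+ (y :+ s) := y :+ (x :+ s)) refl (f x) (f y) _)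
  ∑-↭ f (Perm.trans ρ ρ′)  = trans (∑-↭ f ρ) (∑-↭ f ρ′)

  runningOn : Machine n → List (Task n × Carrier)
  runningOn (busy (just a) f) = (a , f) ∷ []
  runningOn _                 = []

  running : ∀ {k} → Vec (Machine n) k → List (Task n × Carrier)
  running []       = []
  running (X ∷ Ms) = runningOn X ++ running Ms

  -- Everything is compared with the state in which machine `i` is idle, the common midpoint of
  -- vacating it and of loading it again.
  running-update : ∀ {k} (Ms : Vec (Machine n) k) i X →
    running (Ms [ i ]≔ X) ↭ runningOn X ++ running (Ms [ i ]≔ idle)
  running-update (_ ∷ Ms) zero    X = ↭-refl
  running-update (Y ∷ Ms) (suc i) X = ↭-trans (++⁺ˡ (runningOn Y) (running-update Ms i X))
    (shifts (runningOn Y) (runningOn X))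

  running-lookup : ∀ {k} (Ms : Vec (Machine n) k) i {X} → Vec.lookup Ms i ≡ X →
    running Ms ↭ runningOn X ++ running (Ms [ i ]≔ idle)
  running-lookup Ms i refl = subst (λ Ms′ → running Ms′ ↭ runningOn (Vec.lookup Ms i) ++ running
      (Ms [ i ]≔ idle)) ([]≔-lookup Ms i) (running-update Ms i (Vec.lookup Ms i))

  running-replicate : ∀ k {X} → runningOn X ≡ [] → running (Vec.replicate k X) ≡ []
  running-replicate zero    eq = refl
  running-replicate (suc k) eq = cong₂ _++_ eq (running-replicate k eq)

  finish : Machine n → Carrier
  finish (busy _ f) = f
  -- A default value; `finishSum` is evaluated only while all machines are busy.
  finish idle       = 0#

  finishSum : Vec (Machine n) m → Carrier
  finishSum M = sum (λ i → finish (Vec.lookup M i))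

  AllBusy : Vec (Machine n) m → Set c
  AllBusy M = ∀ i → ∃[ x ] ∃[ f ] Vec.lookup M i ≡ busy x f

  -- The least finishing time is at most the average one.
  first-idle-≤ : ∀ M {i x f} → AllBusy M → BecomesIdle M i x f → fromℕ m * f ≤ finishSum M
  first-idle-≤ M {f = f} all-busy (_ , f≤) = subst (_≤ finishSum M) (sum-constant m f) (sum-mono-≤ f≤finish)
    where
    f≤finish : ∀ i → f ≤ finish (Vec.lookup M i)
    f≤finish i with all-busy i
    ... | y , g , eq = subst (λ X → f ≤ finish X) (sym eq) (f≤ i eq)

  AllBusy-update : ∀ M i x f → AllBusy M → AllBusy (M [ i ]≔ busy x f)
  AllBusy-update M i x f all-busy k with k Fin.≟ i
  ... | yes refl = x , f , lookup∘update i M (busy x f)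
  ... | no k≢i with all-busy k
  ...   | y , g , eq = y , g , trans (lookup∘update′ k≢i M (busy x f)) eq

  finishSum-update : ∀ M i {x f} y d → Vec.lookup M i ≡ busy x f →
    finishSum (M [ i ]≔ busy y (f + d)) ≡ finishSum M + d
  finishSum-update M i {x} {f} y d eq = sum-increment {f = λ k → finish (Vec.lookup M k)} i d
    (trans (cong finish (lookup∘update i M (busy y (f + d)))) (cong (λ X → finish X + d) (sym eq)))
    (λ k k≢i → cong finish (lookup∘update′ k≢i M (busy y (f + d))))

  job-initialTask : ∀ j → job (initialTask coins j) ≡ j
  job-initialTask j with coin j
  ... | true  = refl
  ... | false = refl

  jobs : List (Task n) → List (Fin n)
  jobs = map job

  runningJobs : List (Task n × Carrier) → List (Fin n)
  runningJobs = map (λ (a , _) → job a)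

  Heavier : Fin n → Task n → Set (c ⊔ ℓ)
  Heavier k a = t (I k) + p (I k) < weight a

  delays : (Fin n → Fin n → Carrier) → Fin n → Carrier
  delays delay k = sum (λ j → delay j k)

  module _ (phase : Fin n → Phase) where

    started-work : Carrier
    started-work = sum (λ j → progress (phase j) j)

    OnMachine : Task n → Set
    OnMachine (test j) = InTest (phase j)
    OnMachine _        = ⊤

    -- Requiring `testing` for a queued execution expresses promptness: the execution of a prompt
    -- job never waits in the queue.
    QueuedOk : Task n → Set
    QueuedOk (test j)     = coin j ≡ true × phase j ≡ waiting
    QueuedOk (execute j)  = phase j ≡ testing
    QueuedOk (untested j) = coin j ≡ false × phase j ≡ waiting

  module _ (phase : Fin n → Phase) (delay : Fin n → Fin n → Carrier) where

    -- m times a bound on the time at which the tasks of k started so far end.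
    due : Fin n → Carrier
    due k = delays delay k + fromℕ m * progress (phase k) k

    RunningOk : Task n × Carrier → Set ℓ
    RunningOk (a , f) = fromℕ m * f ≤ due (job a) × OnMachine phase a

  -- The invariant of a run. By `conserved` each job occurs exactly once among the completed,
  -- running and queued ones. By `no-idling` the finishing times add up to the work started for as
  -- long as some job is counting, which converts work into time.
  record Config (M : Vec (Machine n) m) (Q : List (Task n)) (C : Carrier) : Set (c ⊔ ℓ) where
    field
      phase          : Fin n → Phase
      delay          : Fin n → Fin n → Carrier
      accounts       : Accounts phase delay
      completedJobs  : List (Fin n)
      conserved      : completedJobs ++ runningJobs (running M) ++ jobs Q ↭ allFin n
      cost-≤         : fromℕ m * C ≤ ∑ completedJobs (due phase delay)
      running-ok     : All (RunningOk phase delay) (running M)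
      queue-ok       : All (QueuedOk phase) Q
      waiting-queued : ∀ k → phase k ≡ waiting → initialTask coins k ∈ Q
      prompt-light   : ∀ k → phase k ≡ prompt → All (Heavier k) Q
      no-idling      : ∀ k → Counting (phase k) → AllBusy M × finishSum M ≡ started-work phase

  -- The task last run on the machine that becomes idle at time f has been
  -- removed, and rel is what it releases into the queue.
  record Vacated (R : List (Task n × Carrier)) (rel Q : List (Task n)) (C f : Carrier)
    (phase : Fin n → Phase) (delay : Fin n → Fin n → Carrier) : Set (c ⊔ ℓ) where
    field
      completedJobs : List (Fin n)
      conserved     : completedJobs ++ runningJobs R ++ jobs (rel ++ Q) ↭ allFin n
      cost-≤        : fromℕ m * C ≤ ∑ completedJobs (due phase delay)
      running-ok    : All (RunningOk phase delay) R
      released-ok   : rel ≡ [] ⊎ ∃[ j ] rel ≡ execute j ∷ [] × InTest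
          (phase j) × fromℕ m * f ≤ due phase delay j

  vacate : ∀ {M Q C i x f} (S : Config M Q C) → BecomesIdle M i x f →
    Vacated (running (M [ i ]≔ idle)) (released x) Q (C + completed x f) f (Config.phase S) (Config.delay S)
  vacate {M} {Q} {C} {i} {x} {f} S (eq , _) = go x (running-lookup M i eq)
    where
    open Config S
    R = running (M [ i ]≔ idle)
    cost-same : fromℕ m * (C + 0#) ≤ ∑ completedJobs (due phase delay)
    cost-same = subst (λ z → fromℕ m * z ≤ ∑ completedJobs (due phase delay)) (sym (+-identityʳ C)) cost-≤
    cost-more : ∀ {j} → fromℕ m * f ≤ due phase delay j → fromℕ m * (C + f) ≤ ∑ (j ∷ completedJobs)
        (due phase delay)
    cost-more {j} f≤ = subst (_≤ ∑ (j ∷ completedJobs) (due phase delay))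
      (solve 3 (λ m c f → m :* f :+ m :* c := m :* (c :+ f)) refl (fromℕ m) C f) (+-mono-≤ f≤ cost-≤)
    move : ∀ {j} → runningJobs (running M) ↭ j ∷ runningJobs R →
      j ∷ completedJobs ++ runningJobs R ++ jobs Q ↭ allFin n
    move {j} ρ = ↭-trans (↭-sym (↭-trans (++⁺ˡ completedJobs (++⁺ʳ (jobs Q) ρ))
        (shift j completedJobs (runningJobs R ++ jobs Q)))) conserved
    go : ∀ x → running M ↭ runningOn (busy x f) ++ R → Vacated R (released x) Q
        (C + completed x f) f phase delay
    go nothing ρ = record
      { completedJobs = completedJobs
      ; conserved     = ↭-trans (++⁺ˡ completedJobs (++⁺ʳ (jobs Q) (map⁺ _ (↭-sym ρ)))) conserved
      ; cost-≤        = cost-same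
      ; running-ok    = All-resp-↭ ρ running-ok
      ; released-ok   = inj₁ refl
      }
    go (just (test j)) ρ with All-resp-↭ ρ running-ok
    ... | (f≤ , inTest) ∷ R-ok = record
      { completedJobs = completedJobs
      ; conserved     = ↭-trans (++⁺ˡ completedJobs
          (↭-trans (shift j (runningJobs R) (jobs Q)) (++⁺ʳ (jobs Q) (map⁺ _ (↭-sym ρ))))) conserved
      ; cost-≤        = cost-same
      ; running-ok    = R-ok
      ; released-ok   = inj₂ (j , refl , inTest , f≤)
      }
    go (just (execute j)) ρ with All-resp-↭ ρ running-ok
    ... | (f≤ , _) ∷ R-ok = record
      { completedJobs = j ∷ completedJobs
      ; conserved     = move (map⁺ _ ρ)
      ; cost-≤        = cost-more f≤
      ; running-ok    = R-ok
      ; released-ok   = inj₁ refl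
      }
    go (just (untested j)) ρ with All-resp-↭ ρ running-ok
    ... | (f≤ , _) ∷ R-ok = record
      { completedJobs = j ∷ completedJobs
      ; conserved     = move (map⁺ _ ρ)
      ; cost-≤        = cost-more f≤
      ; running-ok    = R-ok
      ; released-ok   = inj₁ refl
      }

  module Launch {M Q C i x f a Q′} (S : Config M Q C) (becomes-idle : BecomesIdle M i x f)
    (pick : released x ++ Q ↭ a ∷ Q′) (lightest : All (λ b → weight a ≤ weight b) Q′) where

    open Config S using (phase; delay; accounts; queue-ok; waiting-queued; prompt-light; no-idling)
    open Vacated (vacate S becomes-idle)
    open Accounts accounts

    rel = released x
    R = running (M [ i ]≔ idle)
    k = job a
    d = duration I a

    -- The lists in `conserved` enumerate `allFin n` without repetition, and the picked task
    -- accounts for the one occurrence of `k`.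
    others-distinct : All (k ≢_) (runningJobs R ++ jobs Q′)
    others-distinct with Unique-resp-↭ (↭-trans (↭-sym conserved)
      (↭-trans (++⁺ˡ completedJobs (↭-trans (++⁺ˡ (runningJobs R) (map⁺ job pick))
          (shift k (runningJobs R) (jobs Q′))))
        (shift k completedJobs (runningJobs R ++ jobs Q′)))) (Unique.allFin⁺ n)
    ... | k∉ ∷ _ = All.tabulate (λ z∈ → All.lookup k∉ (∈-++⁺ʳ completedJobs z∈))

    queued-≢ : ∀ {b} → b ∈ Q′ → job b ≢ k
    queued-≢ b∈ eq = All.lookup others-distinct (∈-++⁺ʳ (runningJobs R) (∈-map⁺ job b∈)) (sym eq)

    running-≢ : ∀ {b g} → (b , g) ∈ R → job b ≢ k
    running-≢ b∈ eq = All.lookup others-distinct (∈-++⁺ˡ (∈-map⁺ (λ (a , _) → job a) b∈)) (sym eq)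

    origin : ∀ {b} → b ∈ rel ++ Q → (b ∈ Q) ⊎ ∃[ j ] b ≡ execute j × rel ≡ execute j ∷ [] × InTest
        (phase j) × fromℕ m * f ≤ due phase delay j
    origin b∈ with ∈-++⁻ rel b∈
    ... | inj₂ b∈Q = inj₁ b∈Q
    ... | inj₁ b∈rel with released-ok
    ...   | inj₁ rel≡[] = contradiction (subst (_ ∈_) rel≡[] b∈rel) λ ()
    ...   | inj₂ (j , rel≡ , inTest , f≤) with subst (_ ∈_) rel≡ b∈rel
    ...     | here refl = inj₂ (j , refl , rel≡ , inTest , f≤)

    a-origin : (a ∈ Q) ⊎ ∃[ j ] a ≡ execute j × rel ≡ execute j ∷ [] × InTest
        (phase j) × fromℕ m * f ≤ due phase delay j
    a-origin = origin (∈-resp-↭ (↭-sym pick) (here refl))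

    Q′-origin : ∀ {b} → b ∈ Q′ → (b ∈ Q) ⊎ ∃[ j ] b ≡ execute j × rel ≡ execute j ∷ [] × InTest
        (phase j) × fromℕ m * f ≤ due phase delay j
    Q′-origin b∈ = origin (∈-resp-↭ (↭-sym pick) (there b∈))

    still-queued : ∀ {b} → b ∈ Q → job b ≢ k → b ∈ Q′
    still-queued b∈Q b≢ with ∈-resp-↭ pick (∈-++⁺ʳ rel b∈Q)
    ... | here refl = contradiction refl b≢
    ... | there b∈  = b∈

    startable : Startable a (phase k)
    startable = [ from-queue , from-release ]′ a-origin
      where
      from-queue : a ∈ Q → Startable a (phase k)
      from-queue a∈Q = go a (All.lookup queue-ok a∈Q)
        where
        go : ∀ b → QueuedOk phase b → Startable b (phase (job b))
        go (test j)     (tails , w) = subst (Startable (test j)) (sym w) (test tails)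
        go (untested j) (heads , w) = subst (Startable (untested j)) (sym w) (untested heads)
        go (execute j)  w = execute (subst InTest (sym w) tt) (tested j (subst InTest (sym w) tt))
      from-release : _ → Startable a (phase k)
      from-release (j , refl , _ , inTest , _) = execute inTest (tested j inTest)

    waiting-heavy : ∀ l → l ≢ k → phase l ≡ waiting → weight a ≤ weight (initialTask coins l)
    waiting-heavy l l≢k w = All.lookup lightest (still-queued (waiting-queued l w)
        (λ eq → l≢k (trans (sym (job-initialTask l)) eq)))

    open StartTask a accounts startable waiting-heavy hiding (i)

    counted-work : Counting (phase k) → started-work phase ≡ delays delay k + progress (phase k) k
    counted-work counting = sum-increment k (progress (phase k) k)
      (sym (trans (cong (_+ progress (phase k) k) (delay-self k)) (+-identityˡ _)))
      (λ j j≢k → sym (counted j k j≢k counting))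

    -- If `a` was already queued, its job is counting, so `m * f` is at most all the work started,
    -- which consists of the delays of `k` and its own progress. If `a` has just been released, it
    -- starts at the end of its test and inherits the bound for that.
    start-≤ : fromℕ m * f ≤ due phase delay k
    start-≤ = [ from-queue , (λ { (j , refl , _ , _ , f≤) → f≤ }) ]′ a-origin
      where
      from-queue : a ∈ Q → fromℕ m * f ≤ due phase delay k
      from-queue a∈Q = ≤-trans (first-idle-≤ M (proj₁ (no-idling k counting)) becomes-idle)
        (≤-trans (≤-reflexive (trans (proj₂ (no-idling k counting)) (counted-work counting)))
          (+-monoʳ-≤ (delays delay k) (subst (_≤ fromℕ m * progress (phase k) k) (*-identityˡ _)
            (*-monoʳ-≤ (progress-nonNeg (phase k) k) (1≤fromℕ m)))))
        where
        go : ∀ b → QueuedOk phase b → Counting (phase (job b))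
        go (test j)     (_ , w) = subst Counting (sym w) tt
        go (untested j) (_ , w) = subst Counting (sym w) tt
        go (execute j)  w       = subst Counting (sym w) tt
        counting : Counting (phase k)
        counting = go a (All.lookup queue-ok a∈Q)

    progress≤progress′ : ∀ l → progress (phase l) l ≤ progress (phase′ l) l
    progress≤progress′ l with l Fin.≟ k
    ... | yes refl = subst (progress (phase k) k ≤_) (sym (startable-progress startable))
        (x≤x+y (duration-nonNeg a))
    ... | no l≢k   = ≤-reflexive (sym (Updated-progress (updated (weight a) l (phase l) (waiting-heavy l l≢k))))

    delays≤delays′ : ∀ l → delays delay l ≤ delays delay′ l
    delays≤delays′ l = sum-mono-≤ (λ j → delay≤delay′ j l)

    due≤due′ : ∀ l → due phase delay l ≤ due phase′ delay′ l
    due≤due′ l = +-mono-≤ (delays≤delays′ l) (*-monoˡ-≤ (fromℕ-nonNeg m) (progress≤progress′ l))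

    end-≤ : fromℕ m * (f + d) ≤ due phase′ delay′ k
    end-≤ = ≤-trans (subst (_≤ due phase delay k + fromℕ m * d)
        (solve 3 (λ m f d → m :* f :+ m :* d := m :* (f :+ d)) refl (fromℕ m) f d) (+-mono-≤ start-≤ ≤-refl))
      (≤-trans (≤-reflexive (trans (solve 4 (λ D m w d → D :+ m :* w :+ m :* d := D :+ m :* (w :+ d)) refl
          (delays delay k) (fromℕ m) (progress (phase k) k) d)
          (cong (λ w → delays delay k + fromℕ m * w) (sym progress′-self))))
        (+-mono-≤ (delays≤delays′ k) ≤-refl))

    on-machine : ∀ b → job b ≢ k → OnMachine phase b → OnMachine phase′ b
    on-machine (test j)     b≢ inTest = Updated-inTest′ (phase′-other j b≢) inTest
    on-machine (execute j)  b≢ _      = tt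
    on-machine (untested j) b≢ _      = tt

    launched : ∀ b → b ≡ a → OnMachine phase′ b
    launched (test j)     refl = subst InTest (sym phase′-self) tt
    launched (execute j)  _    = tt
    launched (untested j) _    = tt

    running-ok′ : ∀ {b} → b ∈ (a , f + d) ∷ R → RunningOk phase′ delay′ b
    running-ok′ (here refl) = end-≤ , launched a refl
    running-ok′ {b} (there b∈) = ≤-trans (proj₁ (All.lookup running-ok b∈)) (due≤due′ _) ,
      on-machine (proj₁ b) (running-≢ b∈) (proj₂ (All.lookup running-ok b∈))

    -- The execution of a prompt job is not left behind when it is released: any task picked from
    -- the old queue in its place would be heavier, contrary to `lightest`.
    not-prompt : ∀ j ph → phase j ≡ ph → InTest ph → execute j ∈ Q′ → rel ≡ execute j ∷ [] → phase j ≡ testing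
    not-prompt j testing eq _ _ _ = eq
    not-prompt j prompt eq _ b∈ rel≡ with a-origin
    ... | inj₁ a∈Q = contradiction (All.lookup lightest b∈) (<⇒≱ (All.lookup (prompt-light j eq) a∈Q))
    ... | inj₂ (l , refl , rel≡′ , _) = contradiction (same (trans (sym rel≡) rel≡′)) (queued-≢ b∈)
      where
      same : ∀ {l l′} → List._∷_ {A = Task n} (execute l) [] ≡ execute l′ ∷ [] → l ≡ l′
      same refl = refl

    queue-ok′ : ∀ {b} → b ∈ Q′ → QueuedOk phase′ b
    queue-ok′ {b} b∈ = [ (λ b∈Q → kept b b∈ (All.lookup queue-ok b∈Q)) , released-kept ]′ (Q′-origin b∈)
      where
      -- A task that demotes `j` is heavier than the execution of `j`, so it cannot be picked while
      -- that execution is queued.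
      stays-testing : ∀ j → execute j ∈ Q′ → phase j ≡ testing → phase′ j ≡ testing
      stays-testing j b∈ eq = go (phase′-other j (queued-≢ b∈)) eq
        where
        go : ∀ {ph ph′} → Updated (weight a) j ph ph′ → ph ≡ testing → ph′ ≡ testing
        go (testing _) _ = refl
        go (demoted lt) _ = contradiction (All.lookup lightest b∈) (<⇒≱ lt)
      kept : ∀ b → b ∈ Q′ → QueuedOk phase b → QueuedOk phase′ b
      kept (test j)     b∈ (eq , w) = eq , Updated-waiting (phase′-other j (queued-≢ b∈)) w
      kept (untested j) b∈ (eq , w) = eq , Updated-waiting (phase′-other j (queued-≢ b∈)) w
      kept (execute j)  b∈ w        = stays-testing j b∈ w
      released-kept : _ → QueuedOk phase′ b
      released-kept (j , refl , rel≡ , inTest , _) = stays-testing j b∈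
          (not-prompt j (phase j) refl inTest b∈ rel≡)

    waiting-queued′ : ∀ l → phase′ l ≡ waiting → initialTask coins l ∈ Q′
    waiting-queued′ l w = go (l Fin.≟ k)
      where
      next≢waiting : ∀ b → next b ≢ waiting
      next≢waiting (test _) ()
      next≢waiting (execute _) ()
      next≢waiting (untested _) ()
      go : Dec (l ≡ k) → initialTask coins l ∈ Q′
      go (yes refl) = contradiction (trans (sym phase′-self) w) (next≢waiting a)
      go (no l≢k) = still-queued (waiting-queued l (Updated-waiting′ (phase′-other l l≢k) w))
        (λ eq → l≢k (trans (sym (job-initialTask l)) eq))

    -- All that remains is at least as heavy as `a`, so it suffices that `a` is heavier than the
    -- execution of `l`; this also covers a freshly released execution that stays behind. If `a` is
    -- itself the released task, the old queue remains unchanged up to order.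
    prompt-light′ : ∀ l → phase′ l ≡ prompt → All (Heavier l) Q′
    prompt-light′ l w = go (l Fin.≟ k)
      where
      next≢prompt : ∀ b → next b ≢ prompt
      next≢prompt (test _) ()
      next≢prompt (execute _) ()
      next≢prompt (untested _) ()
      from-a : t (I l) + p (I l) < weight a → All (Heavier l) Q′
      from-a lt = All.map (<-≤-trans lt) lightest
      still : All (Heavier l) Q → All (Heavier l) Q′
      still heavy with a-origin
      ... | inj₁ a∈Q = from-a (All.lookup heavy a∈Q)
      ... | inj₂ (j , refl , rel≡ , _) = All-resp-↭ (drop-∷ (subst (λ r → r ++ Q ↭ a ∷ Q′) rel≡ pick)) heavy
      by-update : ∀ {ph ph′} → Updated (weight a) l ph ph′ → phase l ≡ ph → ph′ ≡ prompt → All (Heavier l) Q′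
      by-update (demoted lt) _ _ = from-a lt
      by-update prompt eq _ = still (prompt-light l eq)
      go : Dec (l ≡ k) → All (Heavier l) Q′
      go (yes refl) = contradiction (trans (sym phase′-self) w) (next≢prompt a)
      go (no l≢k) = by-update (phase′-other l l≢k) refl w

    M′ : Vec (Machine n) m
    M′ = M [ i ]≔ busy (just a) (f + d)

    -- The machine is reloaded at the very time `f` at which it becomes idle, so both sums grow by
    -- `d`.
    no-idling′ : ∀ l → Counting (phase′ l) → AllBusy M′ × finishSum M′ ≡ started-work phase′
    no-idling′ l counting with no-idling l (counting-before l counting)
    ... | all-busy , eq = AllBusy-update M i (just a) (f + d) all-busy ,
      trans (finishSum-update M i (just a) d (proj₁ becomes-idle))
        (trans (cong (_+ d) eq) (sym (sum-increment k d progress′-self progress′-other)))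

    config′ : Config M′ Q′ (C + completed x f)
    config′ = record
      { phase          = phase′
      ; delay          = delay′
      ; accounts       = accounts′
      ; completedJobs  = completedJobs
      ; conserved      = ↭-trans (++⁺ˡ completedJobs
          (↭-trans (++⁺ʳ (jobs Q′) (map⁺ _ (running-update M i (busy (just a) (f + d)))))
          (↭-trans (↭-sym (shift k (runningJobs R) (jobs Q′)))
              (++⁺ˡ (runningJobs R) (map⁺ job (↭-sym pick)))))) conserved
      ; cost-≤         = ≤-trans cost-≤ (sum-mono-≤ (λ l → due≤due′ (lookup completedJobs l)))
      ; running-ok     = All-resp-↭ (↭-sym (running-update M i (busy (just a) (f + d))))
          (All.tabulate running-ok′)
      ; queue-ok       = All.tabulate queue-ok′
      ; waiting-queued = waiting-queued′
      ; prompt-light   = prompt-light′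
      ; no-idling      = no-idling′
      }

  -- A machine stops only when the queue is empty. No job is waiting then, and vacuously all queued
  -- tasks are heavier than any execution, so each testing job may be declared prompt and no job
  -- counts any longer.
  freeze : Phase → Phase
  freeze testing = prompt
  freeze ph      = ph

  module Stop {M Q C i x f} (S : Config M Q C) (becomes-idle : BecomesIdle M i x f)
    (empty : released x ++ Q ≡ []) where

    open Config S using (phase; delay; accounts; queue-ok; waiting-queued; prompt-light; no-idling)
    open Vacated (vacate S becomes-idle)
    open Accounts accounts

    Q≡[] : Q ≡ []
    Q≡[] = ++-conicalʳ (released x) Q empty

    phase′ : Fin n → Phase
    phase′ k = freeze (phase k)

    not-counting : ∀ k ph → phase k ≡ ph → ¬ Counting (freeze ph)
    not-counting k waiting eq _ with subst (_ ∈_) Q≡[] (waiting-queued k eq)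
    ... | ()

    freeze-progress : ∀ ph k → progress (freeze ph) k ≡ progress ph k
    freeze-progress waiting k = refl
    freeze-progress testing k = refl
    freeze-progress prompt  k = refl
    freeze-progress started k = refl

    freeze-inTest : ∀ ph → InTest (freeze ph) → InTest ph
    freeze-inTest testing _ = tt
    freeze-inTest prompt  _ = tt

    freeze-inTest′ : ∀ ph → InTest ph → InTest (freeze ph)
    freeze-inTest′ testing _ = tt
    freeze-inTest′ prompt  _ = tt

    accounts′ : Accounts phase′ delay
    accounts′ = record
      { tested     = λ k inTest → tested k (freeze-inTest (phase k) inTest)
      ; delay-self = delay-self
      ; counted    = λ j k _ counting → contradiction counting (not-counting k (phase k) refl)
      ; delay≤     = λ j k j≢k → subst (delay j k ≤_) (sym (freeze-progress (phase j) j)) (delay≤ j k j≢k)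
      ; paired     = λ j k j≢k → [ inj₁ , (λ (j-started , both) → inj₂ (cong freeze j-started , both)) ]′
          (paired j k j≢k)
      }

    due≡ : ∀ k → due phase delay k ≡ due phase′ delay k
    due≡ k = cong (λ w → delays delay k + fromℕ m * w) (sym (freeze-progress (phase k) k))

    on-machine : ∀ b → OnMachine phase b → OnMachine phase′ b
    on-machine (test j)     inTest = freeze-inTest′ (phase j) inTest
    on-machine (execute j)  _ = tt
    on-machine (untested j) _ = tt

    config′ : Config (M [ i ]≔ idle) [] (C + completed x f)
    config′ = record
      { phase          = phase′
      ; delay          = delay
      ; accounts       = accounts′
      ; completedJobs  = completedJobs
      ; conserved      = subst (λ q → completedJobs ++ runningJobs
          (running (M [ i ]≔ idle)) ++ jobs q ↭ allFin n) empty conserved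
      ; cost-≤         = ≤-trans cost-≤ (sum-mono-≤ (λ l → ≤-reflexive (due≡ (lookup completedJobs l))))
      ; running-ok     = All.map (λ {b} (f≤ , ok) → ≤-trans f≤
          (≤-reflexive (due≡ (job (proj₁ b)))) , on-machine (proj₁ b) ok) running-ok
      ; queue-ok       = []
      ; waiting-queued = λ k w → contradiction (subst Counting (sym w) tt) (not-counting k (phase k) refl)
      ; prompt-light   = λ _ _ → []
      ; no-idling      = λ k counting → contradiction counting (not-counting k (phase k) refl)
      }

  ConfigOf : State m n → Set (c ⊔ ℓ)
  ConfigOf ⟨ M , Q , C ⟩ = Config M Q C

  step : ∀ {s s′} → s ⟶ s′ → ConfigOf s → ConfigOf s′
  step (run becomes-idle pick lightest) S = Launch.config′ S becomes-idle pick lightest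
  step (stop becomes-idle empty)        S = Stop.config′ S becomes-idle empty

  steps : ∀ {s s′} → Star _⟶_ s s′ → ConfigOf s → ConfigOf s′
  steps ε        S = S
  steps (s ◅ ss) S = steps ss (step s S)

  config-initial : ConfigOf (initial coins)
  config-initial = record
    { phase          = λ _ → waiting
    ; delay          = λ _ _ → 0#
    ; accounts       = accounts-initial
    ; completedJobs  = []
    ; conserved      = ↭-reflexive (trans (cong (λ R → runningJobs R ++ jobs (tabulate (initialTask coins)))
        nothing-runs)
        (trans (map-tabulate (initialTask coins) job) (tabulate-cong job-initialTask)))
    ; cost-≤         = ≤-reflexive (zeroʳ (fromℕ m))
    ; running-ok     = subst (All _) (sym nothing-runs) []
    ; queue-ok       = All.tabulate (λ b∈ → queued (∈-tabulate⁻ b∈))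
    ; waiting-queued = λ k _ → ∈-tabulate⁺ k
    ; prompt-light   = λ _ ()
    ; no-idling      = λ _ _ → (λ i → nothing , 0# , lookup-replicate i (busy nothing 0#)) ,
        trans (sum-cong-≗ {m} (λ i → cong finish (lookup-replicate i (busy nothing 0#))))
          (trans (sum-replicate-zero m) (sym (sum-replicate-zero n)))
    }
    where
    nothing-runs : running (Vec.replicate m (busy nothing 0#)) ≡ []
    nothing-runs = running-replicate m refl
    queued : ∀ {b} → ∃ (λ j → b ≡ initialTask coins j) → QueuedOk (λ _ → waiting) b
    queued (j , refl) with coin j in eq
    ... | true  = eq , refl
    ... | false = eq , refl

  -- In the final state nothing is running or queued, so by `conserved` the completed jobs are all
  -- jobs, each contributing its due time.
  run-cost-≤ : ∀ {C} → IsCost coins C → ∃[ delay ]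
    (∀ j → delay j j ≡ 0#) ×
    (∀ j k → j ≢ k → delay j k + delay k j ≤ pairBound (coin k) (I k)) ×
    fromℕ m * C ≤ sum (λ k → sum (λ j → delay j k) + fromℕ m * total k)
  run-cost-≤ {C} trace = delay , delay-self , pair-≤ , ≤-trans cost-≤ (≤-trans
      (≤-reflexive (trans (∑-↭ (due phase delay) all-completed)
          (sum-lookup-tabulate (due phase delay) (λ k → k))))
      (sum-mono-≤ (λ k → +-monoʳ-≤ (delays delay k)
          (*-monoˡ-≤ (fromℕ-nonNeg m) (progress≤total (phase k) k (tested k))))))
    where
    open Config (steps trace config-initial)
    open Accounts accounts
    all-completed : completedJobs ↭ allFin n
    all-completed = ↭-trans (↭-reflexive (sym (trans
        (cong (λ R → completedJobs ++ runningJobs R ++ []) (running-replicate m refl))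
      (++-identityʳ completedJobs)))) conserved

-- Expectation over independent coins.

module Expectation {c ℓ} (F : OrderedField c ℓ) where
  open OrderedField F
  open Arithmetic F
  open Scheduling F

  mix : Carrier → (Bool → Carrier) → Carrier
  mix q h = q * h true + (1# - q) * h false

  mix-mono : ∀ {q} {g h : Bool → Carrier} → 0# ≤ q → q ≤ 1# → (∀ b → g b ≤ h b) → mix q g ≤ mix q h
  mix-mono 0≤q q≤1 g≤h = +-mono-≤ (*-monoˡ-≤ 0≤q (g≤h true)) (*-monoˡ-≤ (0≤-difference q≤1) (g≤h false))

  mix-const : ∀ q x → mix q (λ _ → x) ≡ x
  mix-const = solve 2 (λ q x → q :* x :+ (con (ℤ.+ 1) :- q) :* x := x) refl

  𝔼-mono : ∀ {n} {q : Fin n → Carrier} {f g : Vec Bool n → Carrier} → (∀ j → 0# ≤ q j) → (∀ j → q j ≤ 1#) →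
    (∀ v → f v ≤ g v) → 𝔼 q f ≤ 𝔼 q g
  𝔼-mono {zero}  0≤q q≤1 f≤g = f≤g []
  𝔼-mono {suc n} {q} {f} {g} 0≤q q≤1 f≤g = mix-mono {g = λ b → 𝔼 q′ (λ v → f (b ∷ v))}
      {h = λ b → 𝔼 q′ (λ v → g (b ∷ v))}
    (0≤q zero) (q≤1 zero) (λ b → 𝔼-mono (λ j → 0≤q (suc j)) (λ j → q≤1 (suc j)) (λ v → f≤g (b ∷ v)))
    where
    q′ : Fin n → Carrier
    q′ j = q (suc j)

  𝔼-const : ∀ {n} (q : Fin n → Carrier) x → 𝔼 q (λ _ → x) ≡ x
  𝔼-const {zero}  q x = refl
  𝔼-const {suc n} q x = trans (cong (λ y → q zero * y + (1# - q zero) * y) (𝔼-const (λ j → q (suc j)) x))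
      (mix-const (q zero) x)

  𝔼-+ : ∀ {n} (q : Fin n → Carrier) (f g : Vec Bool n → Carrier) → 𝔼 q (λ v → f v + g v) ≡ 𝔼 q f + 𝔼 q g
  𝔼-+ {zero}  q f g = refl
  𝔼-+ {suc n} q f g = trans
    (cong₂ (λ x y → q zero * x + (1# - q zero) * y) (𝔼-+ (λ j → q (suc j)) _ _) (𝔼-+ (λ j → q (suc j)) _ _))
    (solve 5 (λ q a b c d → q :* (a :+ b) :+ (con (ℤ.+ 1) :- q) :* (c :+ d) :=
      (q :* a :+ (con (ℤ.+ 1) :- q) :* c) :+ (q :* b :+ (con (ℤ.+ 1) :- q) :* d)) refl (q zero) _ _ _ _)

  𝔼-* : ∀ {n} (q : Fin n → Carrier) x (f : Vec Bool n → Carrier) → 𝔼 q (λ v → x * f v) ≡ x * 𝔼 q f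
  𝔼-* {zero}  q x f = refl
  𝔼-* {suc n} q x f = trans
    (cong₂ (λ y z → q zero * y + (1# - q zero) * z) (𝔼-* (λ j → q (suc j)) x _) (𝔼-* (λ j → q (suc j)) x _))
    (solve 4 (λ q x a b → q :* (x :* a) :+ (con (ℤ.+ 1) :- q) :* (x :* b) := x :*
        (q :* a :+ (con (ℤ.+ 1) :- q) :* b))
      refl (q zero) x _ _)

  𝔼-sum : ∀ {k n} (q : Fin n → Carrier) (f : Fin k → Vec Bool n → Carrier) →
    𝔼 q (λ v → sum (λ i → f i v)) ≡ sum (λ i → 𝔼 q (f i))
  𝔼-sum {zero}  q f = 𝔼-const q 0#
  𝔼-sum {suc k} q f = trans (𝔼-+ q (f zero) _) (cong (𝔼 q (f zero) +_) (𝔼-sum q (λ i → f (suc i))))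

  -- The bound on the cost of an outcome is a sum of terms that each depend on a single coin; this
  -- evaluates their expectations.
  𝔼-lookup : ∀ {n} (q : Fin n → Carrier) k (h : Bool → Carrier) → 𝔼 q (λ v → h (Vec.lookup v k)) ≡ mix (q k) h
  𝔼-lookup q zero    h = cong₂ (λ x y → q zero * x + (1# - q zero) * y)
    (𝔼-const (λ j → q (suc j)) (h true)) (𝔼-const (λ j → q (suc j)) (h false))
  𝔼-lookup q (suc k) h = trans (cong (λ y → q zero * y + (1# - q zero) * y) (𝔼-lookup (λ j → q (suc j)) k h))
    (mix-const (q zero) _)

-- From the cost of single outcomes to the competitive ratio.

module CompetitiveRatio {c ℓ} (F : OrderedField c ℓ) (m : ℕ) .{{_ : NonZero m}} (β : OrderedField.Carrier F)
  (0<β : OrderedField._<_ F (OrderedField.0# F) β) where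

  open OrderedField F
  open Arithmetic F
  open QuadraticForms F using (sum-*)
  open Scheduling F
  open OfflineBound F
  open PairBound F β 0<β
  open Expectation F
  open Job

  M : Carrier
  M = fromℕ m

  M-1 : Carrier
  M-1 = M - 1#

  M-1-nonNeg : 0# ≤ M-1
  M-1-nonNeg = 0≤-difference (1≤fromℕ m)

  module _ {n : ℕ} (I : Instance n) where

    -- The mutual delays of a pair are bounded by `pairBound` at either of its jobs. Choosing by
    -- `p*` depends on the instance and not on the coins, so the expectation is taken at a fixed
    -- job.
    smaller : Fin n → Fin n → Fin n
    smaller j k = if does (p* (I j) ≤? p* (I k)) then j else k

    p*-smaller : ∀ j k → p* (I (smaller j k)) ≡ min (p* (I j)) (p* (I k))
    p*-smaller j k with p* (I j) ≤? p* (I k)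
    ... | yes j≤k = sym (min-≤ j≤k)
    ... | no  j≰k = sym (min-≥ (proj₁ (≰⇒> j≰k)))

    module _ (coins : Vec Bool n) where

      bound outcomeWork : Fin n → Carrier
      bound k = pairBound (Vec.lookup coins k) (I k)
      outcomeWork k = work (Vec.lookup coins k) (I k)

      -- Doubling the total delay collects `δ j k + δ k j` over all ordered pairs. Of the `2 M`
      -- copies of the work on each job, one fills the diagonal of the double sum, one is estimated
      -- by `bound`, and the other `2 (M - 1)` are kept for the comparison with `r`.
      outcome-≤ : ∀ {C} → RPCPM.IsCost m β I coins C →
        fromℕ 2 * M * C ≤
        sum (λ j → sum (λ k → bound (smaller j k))) + (sum bound + fromℕ 2 * M-1 * sum outcomeWork)
      outcome-≤ {C} trace with Run.run-cost-≤ F m β 0<β I coins trace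
      ... | δ , δ-self , pair-≤ , C≤ = ≤-trans twice (subst₂ _≤_
          (solve 3 (λ D Y M → (con (ℤ.+ 2) :* D :+ Y) :+ (Y :+ con (ℤ.+ 2) :* (M :- con (ℤ.+ 1)) :* Y) :=
                     con (ℤ.+ 2) :* (D :+ M :* Y)) refl D (sum outcomeWork) M)
          refl
          (+-mono-≤ pairs (+-mono-≤ (sum-mono-≤ (λ k → work≤pairBound (Vec.lookup coins k) (I k))) ≤-refl)))
        where
        D : Carrier
        D = sum (λ k → sum (λ j → δ j k))

        pair-≤-smaller : ∀ j k → j ≢ k → δ j k + δ k j ≤ bound (smaller j k)
        pair-≤-smaller j k j≢k with p* (I j) ≤? p* (I k)
        ... | yes _ = subst (_≤ bound j) (+-comm (δ k j) (δ j k)) (pair-≤ k j (λ eq → j≢k (sym eq)))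
        ... | no  _ = pair-≤ j k j≢k

        y≤smaller : ∀ j → δ j j + δ j j + outcomeWork j ≤ bound (smaller j j)
        y≤smaller j = subst₂ (λ d k → d + d + outcomeWork j ≤ bound k) (sym (δ-self j)) (sym (same j))
          (≤-trans (≤-reflexive (trans (cong (_+ outcomeWork j) (+-identityˡ 0#))
              (+-identityˡ (outcomeWork j))))
            (work≤pairBound (Vec.lookup coins j) (I j)))
          where
          same : ∀ j → smaller j j ≡ j
          same j with p* (I j) ≤? p* (I j)
          ... | yes _ = refl
          ... | no  _ = refl

        double : sum (λ j → sum (λ k → δ j k + δ k j)) ≡ fromℕ 2 * D
        double = trans (sum-cong-≗ (λ j → ∑-distrib-+ (λ k → δ j k) (λ k → δ k j)))
          (trans (∑-distrib-+ (λ j → sum (λ k → δ j k)) (λ j → sum (λ k → δ k j)))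
            (trans (cong (_+ D) (∑-comm δ)) (solve 1 (λ D → D :+ D := con (ℤ.+ 2) :* D) refl D)))

        pairs : fromℕ 2 * D + sum outcomeWork ≤ sum (λ j → sum (λ k → bound (smaller j k)))
        pairs = subst (_≤ sum (λ j → sum (λ k → bound (smaller j k))))
          (trans (∑-distrib-+ (λ j → sum (λ k → δ j k + δ k j)) outcomeWork) (cong (_+ sum outcomeWork) double))
          (sum-mono-≤ (λ j → sum-mono-≤-at j (outcomeWork j) (y≤smaller j)
              (λ k k≢j → pair-≤-smaller j k (λ eq → k≢j (sym eq)))))

        twice : fromℕ 2 * M * C ≤ fromℕ 2 * (D + M * sum outcomeWork)
        twice = subst₂ _≤_ (solve 2 (λ M C → con (ℤ.+ 2) :* (M :* C) := con (ℤ.+ 2) :* M :* C) refl M C)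
          (cong (fromℕ 2 *_) (trans (∑-distrib-+ (λ k → sum (λ j → δ j k)) (λ k → M * outcomeWork k))
              (cong (D +_) (sum-* M outcomeWork))))
          (*-monoˡ-≤ (fromℕ-nonNeg 2) C≤)

  module _ (P : TestingRule) (R r : Carrier)
    (R-sup : IsSupremum (R-ratio β P) R) (r-sup : IsSupremum (r-ratio P) r) where

    open TestingRule P using (prob≥0; prob≤1)

    ℙ≥0 : ∀ k → 0# ≤ ℙ P k
    ℙ≥0 k = prob≥0 (0<t k) (0<u k)

    ℙ≤1 : ∀ k → ℙ P k ≤ 1#
    ℙ≤1 k = prob≤1 (0<t k) (0<u k)

    mix-pairBound-≤ : ∀ k → mix (ℙ P k) (λ b → pairBound b k) ≤ R * p* k
    mix-pairBound-≤ k = ≤-trans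
      (≤-reflexive (solve 3 (λ q x y → q :* x :+ (con (ℤ.+ 1) :- q) :* y := y :*
          (con (ℤ.+ 1) :- q) :+ x :* q) refl
        (ℙ P k) (pairBound true k) (pairBound false k)))
      (x/y≤z⇒x≤z*y (0<p* k) (proj₁ R-sup k))

    mix-work-≤ : ∀ k → mix (ℙ P k) (λ b → work b k) ≤ r * p* k
    mix-work-≤ k = ≤-trans
      (≤-reflexive (solve 3 (λ q x y → q :* x :+ (con (ℤ.+ 1) :- q) :* y := y :*
          (con (ℤ.+ 1) :- q) :+ x :* q) refl
        (ℙ P k) (work true k) (work false k)))
      (x/y≤z⇒x≤z*y (0<p* k) (proj₁ r-sup k))

    -- Allows the slack of `min-p*-cost` to be multiplied by `R`. Any job would serve as witness,
    -- all the quantities in its ratio being nonnegative.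
    R≥0 : 0# ≤ R
    R≥0 = *-cancelˡ-≤ (0<p* unit) (subst₂ _≤_ (trans (mix-const (ℙ P unit) 0#) (sym (zeroʳ (p* unit))))
        (*-comm R (p* unit))
      (≤-trans (mix-mono {g = λ _ → 0#} (ℙ≥0 unit) (ℙ≤1 unit)
        (λ b → ≤-trans (proj₁ (0<work b unit)) (work≤pairBound b unit))) (mix-pairBound-≤ unit)))
      where
      unit : Job
      unit = record { t = 1# ; u = 1# ; p = 0# ; 0<t = 0≤1 , 0≢1 ; 0<u = 0≤1 , 0≢1 ; 0≤p = ≤-refl ; p≤u = 0≤1 }

    module _ {n : ℕ} (I : Instance n) where

      P* N* : Carrier
      P* = sum (λ k → p* (I k))
      N* = sum (λ j → sum (λ k → min (p* (I j)) (p* (I k))))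

      expected-≤ : ∀ {e} → IsExpectedCost m β P I e → fromℕ 2 * M * e ≤ R * N* +
          (R * P* + fromℕ 2 * M-1 * (r * P*))
      expected-≤ {e} (cost , is-cost , refl) = begin
        fromℕ 2 * M * 𝔼 q cost
          ≈⟨ sym (𝔼-* q (fromℕ 2 * M) cost) ⟩
        𝔼 q (λ v → fromℕ 2 * M * cost v)
          ≤⟨ 𝔼-mono (λ j → ℙ≥0 (I j)) (λ j → ℙ≤1 (I j)) (λ v → outcome-≤ I v (is-cost v)) ⟩
        𝔼 q (λ v → sum (λ j → sum (λ k → bound I v (smaller I j k))) +
            (sum (bound I v) + fromℕ 2 * M-1 * sum (outcomeWork I v)))
          ≈⟨ linear ⟩
        sum (λ j → sum (λ k → 𝔼 q (λ v → bound I v (smaller I j k)))) +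
          (sum (λ k → 𝔼 q (λ v → bound I v k)) + fromℕ 2 * M-1 * sum (λ k → 𝔼 q (λ v → outcomeWork I v k)))
          ≤⟨ +-mono-≤ (sum-mono-≤ (λ j → sum-mono-≤ (λ k → 𝔼-bound (smaller I j k))))
               (+-mono-≤ (sum-mono-≤ 𝔼-bound) (*-monoˡ-≤ (*-nonNeg (fromℕ-nonNeg 2) M-1-nonNeg)
                   (sum-mono-≤ 𝔼-y))) ⟩
        sum (λ j → sum (λ k → R * p* (I (smaller I j k)))) +
          (sum (λ k → R * p* (I k)) + fromℕ 2 * M-1 * sum (λ k → r * p* (I k)))
          ≈⟨ cong₂ _+_ (trans (sum-cong-≗ (λ j → trans (sum-cong-≗ (λ k → cong (R *_) (p*-smaller I j k)))
                 (sum-* R (λ k → min (p* (I j)) (p* (I k))))))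
                     (sum-* R (λ j → sum (λ k → min (p* (I j)) (p* (I k))))))
               (cong₂ _+_ (sum-* R (λ k → p* (I k))) (cong (fromℕ 2 * M-1 *_) (sum-* r (λ k → p* (I k))))) ⟩
        R * N* + (R * P* + fromℕ 2 * M-1 * (r * P*)) ∎
        where
        open import Relation.Binary.Reasoning.PartialOrder (DecTotalOrder.poset decTotalOrder)
        q : Fin n → Carrier
        q j = ℙ P (I j)
        𝔼-bound : ∀ k → 𝔼 q (λ v → bound I v k) ≤ R * p* (I k)
        𝔼-bound k = ≤-trans (≤-reflexive (𝔼-lookup q k (λ b → pairBound b (I k)))) (mix-pairBound-≤ (I k))
        𝔼-y : ∀ k → 𝔼 q (λ v → outcomeWork I v k) ≤ r * p* (I k)
        𝔼-y k = ≤-trans (≤-reflexive (𝔼-lookup q k (λ b → work b (I k)))) (mix-work-≤ (I k))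
        linear : 𝔼 q (λ v → sum (λ j → sum (λ k → bound I v (smaller I j k))) +
            (sum (bound I v) + fromℕ 2 * M-1 * sum (outcomeWork I v))) ≡
          sum (λ j → sum (λ k → 𝔼 q (λ v → bound I v (smaller I j k)))) +
          (sum (λ k → 𝔼 q (λ v → bound I v k)) + fromℕ 2 * M-1 * sum (λ k → 𝔼 q (λ v → outcomeWork I v k)))
        linear = trans (𝔼-+ q _ _) (cong₂ _+_
          (trans (𝔼-sum q (λ j v → sum (λ k → bound I v (smaller I j k))))
              (sum-cong-≗ (λ j → 𝔼-sum q (λ k v → bound I v (smaller I j k)))))
          (trans (𝔼-+ q _ _) (cong₂ _+_ (𝔼-sum q (λ k v → bound I v k))
            (trans (𝔼-* q (fromℕ 2 * M-1) _) (cong (fromℕ 2 * M-1 *_) (𝔼-sum q (λ k v → outcomeWork I v k)))))))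

    ratio : Carrier
    ratio = R * (1# / fromℕ 2 + 1# / (fromℕ 2 * fromℕ m)) + r * (1# - 1# / fromℕ m)

    0<2M : 0# < fromℕ 2 * M
    0<2M = <-≤-trans (0<fromℕ m) (≤-by M (fromℕ-nonNeg m) (solve 1 (λ M → con (ℤ.+ 2) :* M := M :+ M) refl M))

    2M*ratio : fromℕ 2 * M * ratio ≡ R * (M + 1#) + fromℕ 2 * r * M-1
    2M*ratio = trans (solve 6 (λ M R r i j k →
          con (ℤ.+ 2) :* M :* (R :* (con (ℤ.+ 1) :* i :+ con (ℤ.+ 1) :* j) :+ r :*
              (con (ℤ.+ 1) :- con (ℤ.+ 1) :* k)) :=
          R :* (M :* (con (ℤ.+ 2) :* i) :+ (con (ℤ.+ 2) :* M) :* j) :+ con (ℤ.+ 2) :* r :* (M :- M :* k)) refl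
        M R r (fromℕ 2 ⁻¹) ((fromℕ 2 * M) ⁻¹) (M ⁻¹))
      (cong₂ (λ x y → R * x + fromℕ 2 * r * (M - y))
        (cong₂ _+_ (trans (cong (M *_) (*-inverse (0<fromℕ 2))) (*-identityʳ M)) (*-inverse 0<2M))
        (*-inverse (0<fromℕ m)))

    competitive : R ≤ fromℕ 2 * r → ExpectedCompetitiveRatioAtMost m β P ratio
    competitive R≤2r I {e} {o} expected ((S , refl) , _) = *-cancelˡ-≤ 0<2M (≤-trans (expected-≤ I expected)
      (subst (R * N* I + (R * P* I + fromℕ 2 * M-1 * (r * P* I)) ≤_)
        (trans (cong (_* o) (sym 2M*ratio)) (solve 3 (λ x y z → x :* y :* z := x :* (y :* z)) refl
            (fromℕ 2 * M) ratio o))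
        -- After multiplication by `2 M`, the target exceeds the bound of `expected-≤` by `R` times
        -- the slack of `min-p*-cost` plus `(M - 1) (2 r - R)` times the slack of `p*-cost`; the
        -- sign of the latter coefficient comes from `R≤2r`.
        (≤-by _ (+-nonNeg (*-nonNeg R≥0 (0≤-difference (min-p*-cost S)))
            (*-nonNeg (*-nonNeg M-1-nonNeg (0≤-difference R≤2r)) (0≤-difference (p*-cost S))))
          (solve 6 (λ R r M N P o → (R :* (M :+ con (ℤ.+ 1)) :+ con (ℤ.+ 2) :* r :* (M :- con (ℤ.+ 1))) :* o :=
              R :* N :+ (R :* P :+ con (ℤ.+ 2) :* (M :- con (ℤ.+ 1)) :* (r :* P)) :+
              (R :* (con (ℤ.+ 2) :* M :* o :- (N :+ M :* P)) :+
               (M :- con (ℤ.+ 1)) :* (con (ℤ.+ 2) :* r :- R) :* (o :- P))) refl R r M (N* I) (P* I) o))))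

theorem24 : ∀ {c ℓ} (F : OrderedField c ℓ) →
    let open OrderedField F
        open Scheduling F
    in
    ∀ (m : ℕ) .{{_ : NonZero m}} (β : Carrier) → 0# < β →
    ∀ (P : TestingRule) (R r : Carrier) →
    IsSupremum (R-ratio β P) R →
    IsSupremum (r-ratio P) r →
    R ≤ fromℕ 2 * r →
    ExpectedCompetitiveRatioAtMost m β P
      (R * (1# / fromℕ 2 + 1# / (fromℕ 2 * fromℕ m)) + r * (1# - 1# / fromℕ m))
theorem24 F m β 0<β P R r R-sup r-sup R≤2r = CompetitiveRatio.competitive F m β 0<β P R r R-sup r-sup R≤2r
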